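{- Let $\{F^{(n)}\}_{n\ge 2}$ be a uniformly pattern-generated family, with integer $n_0$, fixed patterns $(\mathbf r^{(1)},\mathbf h^{(1)}),\dots,(\mathbf r^{(M)},\mathbf h^{(M)})$ and polynomial $\Psi\in\mathbb{Q}[z_1,\dots,z_M]$ as in the definition of uniform pattern generation. Define $$a(n)=F^{(n)}(\alpha_{1,n},\dots,\alpha_{n-1,n}).$$ Then there exist an integer $n_1$ and a polynomial $R_\infty(n)\in\mathbb{Q}[n]$ such that $a(n)=R_\infty(n)$ for every $n\ge n_1$ satisfying $$\gcd\Bigl(n,\prod_{m=1}^M\prod_j r_j^{(m)}\Bigr)=1.$$
   Context: A pattern $(\mathbf r,\mathbf h)$ consists of an integer $t\ge 1$, a tuple $\mathbf r=(r_1,\dots,r_t)$ of nonzero integers with $r_1=1$, and a tuple $\mathbf h=(h_1,\dots,h_t)$ of nonnegative integers ($t$ may depend on the pattern). For $n\ge 2$ put $\Omega_n=\{1,\dots,n-1\}$ and $\alpha_{k,n}=\cos(2\pi k/n)$ for $k\in\Omega_n$. For an integer $r$ with $\gcd(r,n)=1$, let $\sigma_r:\Omega_n\to\Omega_n$ be the permutation determined by $\sigma_r(k)\equiv rk\pmod n$. If $\gcd(n,r_1\cdots r_t)=1$, the pattern sum is $$T^{(n)}_{\mathbf r,\mathbf h}(x_1,\dots,x_{n-1})=\sum_{k\in\Omega_n}\prod_{j=1}^t\bigl(2x_{\sigma_{r_j}(k)}\bigr)^{h_j}\in\mathbb{Q}[x_1,\dots,x_{n-1}].$$ A family $\{F^{(n)}\}_{n\ge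 2}$ with $F^{(n)}\in\mathbb{Q}[x_1,\dots,x_{n-1}]$ is uniformly pattern-generated if there exist an integer $n_0$, finitely many fixed patterns $(\mathbf r^{(1)},\mathbf h^{(1)}),\dots,(\mathbf r^{(M)},\mathbf h^{(M)})$, and a single polynomial $\Psi\in\mathbb{Q}[z_1,\dots,z_M]$ such that for every integer $n\ge n_0$ with $\gcd\bigl(n,\prod_{m=1}^M\prod_j r_j^{(m)}\bigr)=1$ one has $$F^{(n)}(x_1,\dots,x_{n-1})=\Psi\Bigl(T^{(n)}_{\mathbf r^{(1)},\mathbf h^{(1)}}(x),\dots,T^{(n)}_{\mathbf r^{(M)},\mathbf h^{(M)}}(x)\Bigr).$$ -}

module Defs where

open import Algebra.Apartness.Structures using (IsHeytingField)
open import Algebra.Bundles using (RawRing)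
open import Algebra.Core using (Op₁; Op₂)
open import Algebra.Definitions.RawSemiring using (sum; product; _^_)
open import Algebra.Morphism.Structures using (IsRingHomomorphism)
open import Data.Fin.Base using (Fin; zero; suc; toℕ; fromℕ<)
open import Data.Fin.Properties using (toℕ<n; toℕ-fromℕ<)
open import Data.Integer.Base as ℤ using (ℤ; +_; 0ℤ; 1ℤ; -1ℤ; ∣_∣)
open import Data.Integer.DivMod using (_%ℕ_; _/ℕ_; n%ℕd<d; a≡a%ℕn+[a/ℕn]*n)
open import Data.Integer.Divisibility using (_∣_)
open import Data.Integer.GCD using (gcd; gcd[i,j]∣i; gcd[i,j]∣j; gcd-greatest)
import Data.Integer.Properties as ℤ
open import Data.List.Base as List using (List; []; _∷_; _++_; cartesianProductWith)
open import Data.Nat.Base as ℕ using (ℕ; zero; suc; pred; _!; NonTrivial; NonZero)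
import Data.Nat.Coprimality as Coprimality
import Data.Nat.Divisibility as ℕ
import Data.Nat.Properties as ℕ
open import Data.Product.Base using (_×_; _,_; ∃; map₁)
open import Data.Rational.Base as ℚ using (ℚ; 0ℚ; 1ℚ)
open import Data.Sum.Base using (_⊎_)
import Data.Vec.Base as Vec
open import Data.Vec.Base using (Vec; lookup; replicate; _[_]≔_)
import Data.Vec.Functional as Vector
open import Data.Vec.Properties using (≡-dec)
open import Level using (Level; 0ℓ; _⊔_) renaming (suc to lsuc)
open import Relation.Binary.Core using (Rel)
open import Relation.Binary.Structures using (IsStrictPartialOrder)
open import Relation.Binary.PropositionalEquality.Core
  using (_≡_; refl; sym; trans; cong; subst; _≢_)
open import Relation.Nullary.Decidable.Core using (does)
open import Relation.Nullary.Negation.Core using (¬_)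
open import Data.Bool.Base using (if_then_else_)

------------------------------------------------------------------------
-- The real numbers, up to isomorphism: a Cauchy-complete Archimedean
-- ordered field.  The axioms are the constructive ones (apartness is
-- x < y ⊎ y < x); classically they are the usual ones.

record RealField (c ℓ₁ ℓ₂ : Level) : Set (lsuc (c ⊔ ℓ₁ ⊔ ℓ₂)) where
  infix  8 -_
  infixl 7 _*_
  infixl 6 _+_ _-_
  infix  4 _≈_ _<_
  field
    Carrier : Set c
    _≈_     : Rel Carrier ℓ₁
    _<_     : Rel Carrier ℓ₂
    _+_ _*_ : Op₂ Carrier
    -_      : Op₁ Carrier
    0# 1#   : Carrier

    isHeytingField       : IsHeytingField _≈_ (λ x y → x < y ⊎ y < x) _+_ _*_ -_ 0# 1#
    isStrictPartialOrder : IsStrictPartialOrder _≈_ _<_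
    +-monoˡ-<            : ∀ {x y} z → x < y → x + z < y + z
    *-pos                : ∀ {x y} → 0# < x → 0# < y → 0# < x * y

  rawRing : RawRing c ℓ₁
  rawRing = record
    { Carrier = Carrier ; _≈_ = _≈_ ; _+_ = _+_ ; _*_ = _*_
    ; -_ = -_ ; 0# = 0# ; 1# = 1# }

  _-_ : Op₂ Carrier
  x - y = x + - y

  field
    -- The ring homomorphism ℚ → ℝ is unique; it is part of the structure
    -- only to have a name for it.
    fromℚ                : ℚ → Carrier
    fromℚ-homomorphism   : IsRingHomomorphism ℚ.+-*-rawRing rawRing fromℚ
    archimedean          : ∀ x → ∃ λ (n : ℕ) → x < fromℚ (+ n ℚ./ 1)

  infix 4 _within_of_ _⟶_

  -- ∣ x - y ∣ < ε
  _within_of_ : Carrier → Carrier → Carrier → Set ℓ₂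
  x within ε of y = (y - ε < x) × (x < y + ε)

  _⟶_ : (ℕ → Carrier) → Carrier → Set (c ⊔ ℓ₂)
  s ⟶ l = ∀ ε → 0# < ε → ∃ λ N → ∀ n → N ℕ.≤ n → s n within ε of l

  Cauchy : (ℕ → Carrier) → Set (c ⊔ ℓ₂)
  Cauchy s = ∀ ε → 0# < ε → ∃ λ N → ∀ m n → N ℕ.≤ m → N ℕ.≤ n → s m within ε of s n

  field
    complete : ∀ s → Cauchy s → ∃ λ l → s ⟶ l

module _ {c ℓ₁ ℓ₂} (ℝ : RealField c ℓ₁ ℓ₂) where
  open RealField ℝ
  private _^ʳ_ = _^_ (RawRing.rawSemiring rawRing)

  -- Σ_{k<N} (-1)ᵏ x²ᵏ / (2k)!
  cosPartialSum : Carrier → ℕ → Carrier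
  cosPartialSum x N = sum (RawRing.rawSemiring rawRing) {N} λ i → let k = toℕ i in
    fromℚ (ℚ._/_ (-1ℤ ℤ.^ k) ((2 ℕ.* k) !) {{(2 ℕ.* k) ℕ.!≢0}}) * x ^ʳ (2 ℕ.* k)

  IsCosine : (Carrier → Carrier) → Set (c ⊔ ℓ₂)
  IsCosine cos = ∀ x → cosPartialSum x ⟶ cos x

  -- π / 2 is the least positive zero of the cosine.
  record IsPi (cos : Carrier → Carrier) (π : Carrier) : Set (c ⊔ ℓ₁ ⊔ ℓ₂) where
    π/2 : Carrier
    π/2 = fromℚ ℚ.½ * π
    field
      π/2-positive : 0# < π/2
      π/2-zero     : cos π/2 ≈ 0#
      π/2-least    : ∀ x → 0# < x → x < π/2 → ¬ (cos x ≈ 0#)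

------------------------------------------------------------------------
-- Polynomials over ℚ in m variables: finite formal sums of terms
-- (coefficient , exponent vector), not necessarily collected.  Two such
-- sums are the same polynomial when all collected coefficients agree.

MPoly : ℕ → Set
MPoly m = List (ℚ × Vec ℕ m)

module _ {m : ℕ} where

  coeff : MPoly m → Vec ℕ m → ℚ
  coeff []             e = 0ℚ
  coeff ((q , e′) ∷ p) e =
    if does (≡-dec ℕ._≟_ e′ e) then q ℚ.+ coeff p e else coeff p e

  infix 4 _≈ₚ_
  _≈ₚ_ : Rel (MPoly m) 0ℓ
  p ≈ₚ q = ∀ e → coeff p e ≡ coeff q e

  constₚ : ℚ → MPoly m
  constₚ q = (q , replicate m 0) ∷ []

  varₚ : Fin m → MPoly m
  varₚ i = (1ℚ , replicate m 0 [ i ]≔ 1) ∷ []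

  mulTerm : ℚ × Vec ℕ m → ℚ × Vec ℕ m → ℚ × Vec ℕ m
  mulTerm (q , e) (q′ , e′) = q ℚ.* q′ , Vec.zipWith ℕ._+_ e e′

polyRing : ℕ → RawRing 0ℓ 0ℓ
polyRing m = record
  { Carrier = MPoly m
  ; _≈_     = _≈ₚ_
  ; _+_     = _++_
  ; _*_     = cartesianProductWith mulTerm
  ; -_      = List.map (map₁ λ q → ℚ.- q)
  ; 0#      = []
  ; 1#      = constₚ 1ℚ
  }

-- Evaluation in a ring A containing ℚ via ι; with A a polynomial ring this
-- is substitution.
eval : ∀ {a ℓ m} (A : RawRing a ℓ) (ι : ℚ → RawRing.Carrier A) →
       MPoly m → (Fin m → RawRing.Carrier A) → RawRing.Carrier A
eval A ι []            x = RawRing.0# A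
eval A ι ((q , e) ∷ p) x =
  ι q * product R (λ i → _^_ R (x i) (lookup e i)) + eval A ι p x
  where
  open RawRing A using (_+_; _*_)
  R = RawRing.rawSemiring A

------------------------------------------------------------------------
-- Products of integers and coprimality

∏ : ∀ {m} → (Fin m → ℤ) → ℤ
∏ = Vector.foldr ℤ._*_ 1ℤ

factor∣∏ : ∀ {m} (f : Fin m → ℤ) i → f i ∣ ∏ f
factor∣∏ f zero    = subst (∣ f zero ∣ ℕ.∣_) (sym (ℤ.abs-* (f zero) _)) (ℕ.m∣m*n _)
factor∣∏ f (suc i) = subst (∣ f (suc i) ∣ ℕ.∣_) (sym (ℤ.abs-* (f zero) _))
                       (ℕ.∣n⇒∣m*n ∣ f zero ∣ (factor∣∏ (Vector.tail f) i))

coprime-factor : ∀ {m} n (f : Fin m → ℤ) → gcd n (∏ f) ≡ 1ℤ → ∀ i → gcd n (f i) ≡ 1ℤ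
coprime-factor n f eq i = cong +_ (ℕ.∣1⇒≡1 (subst (λ z → gcd n (f i) ∣ z) eq g∣gcd))
  where
  g = gcd n (f i)
  g∣gcd : g ∣ gcd n (∏ f)
  g∣gcd = gcd-greatest {n} {∏ f} {g} (gcd[i,j]∣i n (f i))
            (ℕ.∣-trans (gcd[i,j]∣j n (f i)) (factor∣∏ f i))

------------------------------------------------------------------------
-- Ωₙ = {1, …, n-1}, the position i : Fin (pred n) standing for i + 1

Ω : ℕ → Set
Ω n = Fin (pred n)

label : ∀ {n} → Ω n → ℕ
label i = suc (toℕ i)

module _ {n : ℕ} .{{_ : NonTrivial n}} (r : ℤ) (cop : gcd (+ n) r ≡ 1ℤ) where

  private instance
    n≢0 : NonZero n
    n≢0 = ℕ.nonTrivial⇒nonZero n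

  residue : Ω n → ℕ
  residue k = (r ℤ.* + label {n} k) %ℕ n

  private
    label<n : ∀ k → label {n} k ℕ.< n
    label<n k = subst (label {n} k ℕ.<_) (ℕ.suc-pred n) (ℕ.s<s (toℕ<n k))

  residue≢0 : ∀ k → residue k ≢ 0
  residue≢0 k eq = ℕ.>⇒∤ (label<n k)
    (Coprimality.coprime-divisor {n} {∣ r ∣} {label {n} k}
      (Coprimality.gcd≡1⇒coprime (ℤ.+-injective cop)) n∣r*k)
    where
    i = r ℤ.* + label {n} k
    i≡qn : i ≡ (i /ℕ n) ℤ.* + n
    i≡qn = trans (a≡a%ℕn+[a/ℕn]*n i n)
             (trans (cong (λ z → + z ℤ.+ (i /ℕ n) ℤ.* + n) eq) (ℤ.+-identityˡ _))
    n∣r*k : n ℕ.∣ ∣ r ∣ ℕ.* label {n} k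
    n∣r*k = ℕ.divides ∣ i /ℕ n ∣
      (trans (sym (ℤ.abs-* r (+ label {n} k)))
        (trans (cong ∣_∣ i≡qn) (ℤ.abs-* (i /ℕ n) (+ n))))

  private
    pred-residue< : ∀ k → pred (residue k) ℕ.< pred n
    pred-residue< k =
      ℕ.pred-mono-< {{ℕ.≢-nonZero (residue≢0 k)}} (n%ℕd<d (r ℤ.* + label {n} k) n)

  σ : Ω n → Ω n
  σ k = fromℕ< (pred-residue< k)

  label-σ : ∀ k → label {n} (σ k) ≡ (r ℤ.* + label {n} k) %ℕ n
  label-σ k = trans (cong suc (toℕ-fromℕ< (pred-residue< k)))
                (ℕ.suc-pred (residue k) {{ℕ.≢-nonZero (residue≢0 k)}})

------------------------------------------------------------------------
-- Patterns and pattern sums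

-- The length of the pattern is t = suc t-1 ≥ 1.
record Pattern : Set where
  field
    t-1  : ℕ
    r    : Fin (suc t-1) → ℤ
    h    : Fin (suc t-1) → ℕ
    r≢0  : ∀ j → r j ≢ 0ℤ
    r₁≡1 : r zero ≡ 1ℤ

patternSum : (P : Pattern) (n : ℕ) .{{_ : NonTrivial n}} →
             gcd (+ n) (∏ (Pattern.r P)) ≡ 1ℤ → MPoly (pred n)
patternSum P n cop =
  sum R λ (k : Ω n) → product R λ j →
    _^_ R (constₚ (+ 2 ℚ./ 1) * varₚ (σ {n} (r j) (coprime-factor (+ n) r cop j) k)) (h j)
  where
  open Pattern P
  open RawRing (polyRing (pred n)) using (_*_)
  R = RawRing.rawSemiring (polyRing (pred n))

Family : Set
Family = (n : ℕ) .{{_ : NonTrivial n}} → MPoly (pred n)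

record UniformlyPatternGenerated (F : Family) : Set where
  field
    n₀       : ℤ
    M        : ℕ
    patterns : Fin M → Pattern
    Ψ        : MPoly M

  modulus : ℤ
  modulus = ∏ λ m → ∏ (Pattern.r (patterns m))

  field
    generates : ∀ n .{{_ : NonTrivial n}} → n₀ ℤ.≤ + n → (cop : gcd (+ n) modulus ≡ 1ℤ) →
      F n ≈ₚ eval (polyRing (pred n)) constₚ Ψ
               (λ m → patternSum (patterns m) n
                        (coprime-factor (+ n) (λ m′ → ∏ (Pattern.r (patterns m′))) cop m))

------------------------------------------------------------------------
-- Evaluation at the cosine values

module _ {c ℓ₁ ℓ₂} (ℝ : RealField c ℓ₁ ℓ₂)
         (cos : RealField.Carrier ℝ → RealField.Carrier ℝ) (π : RealField.Carrier ℝ) where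
  open RealField ℝ

  -- cos (2πk/n)
  α : (n : ℕ) .{{_ : NonTrivial n}} → Ω n → Carrier
  α n k = cos (fromℚ (ℚ._/_ (+ (2 ℕ.* label {n} k)) n {{ℕ.nonTrivial⇒nonZero n}}) * π)

  cosineValue : Family → (n : ℕ) .{{_ : NonTrivial n}} → Carrier
  cosineValue F n = eval rawRing fromℚ (F n) (α n)

evalℚ : MPoly 1 → ℚ → ℚ
evalℚ R q = eval ℚ.+-*-rawRing (λ c → c) R (λ _ → q)

{-# OPTIONS --safe #-}
module Submission where

-- On a cosine sample every pattern sum is affine in n: the product formula expands
-- ∏ⱼ (2 cos rⱼθ) ^ hⱼ into a sum of cos zθ over a fixed multiset of frequencies z, and
-- Σ_{0<k<n} cos (2πkz/n) is n - 1 or - 1 according as n divides z or not, i.e. for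
-- large n according as z = 0 or not.  Then Ψ of these affine functions is R∞.
-- The product formula comes from the Cauchy product of the cosine series, and from it
-- and cos (π/2) = 0 alone follow evenness, periodicity and, as π/2 is the least positive
-- zero, cos (2πz/n) ≠ 1 for 0 < z < n.

open import Defs
open import Algebra.Apartness.Structures using (IsHeytingField)
open import Algebra.Bundles using (CommutativeRing; RawRing)
import Algebra.Definitions.RawSemiring as RawSR
open import Algebra.Morphism.Structures using (IsRingHomomorphism)
import Algebra.Properties.CommutativeMonoid.Sum as MonoidSum
import Algebra.Properties.Ring as RingP
import Algebra.Properties.Semiring.Exp as Exp
import Algebra.Properties.Semiring.Mult.TCOptimised as Mult
import Algebra.Properties.Semiring.Sum as Sum
import Algebra.Solver.Ring as RingSolver
import Algebra.Solver.Ring.AlmostCommutativeRing as ACR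
open import Data.Empty using (⊥)
open import Data.Fin.Base using (Fin; zero; suc; toℕ)
open import Data.Integer.Base as ℤ using (ℤ; +_; -[1+_]; +[1+_]; 0ℤ; 1ℤ; -1ℤ; ∣_∣; _≤_)
open import Data.Integer.DivMod using (_%ℕ_; _/ℕ_; a≡a%ℕn+[a/ℕn]*n)
open import Data.Integer.GCD using (gcd)
import Data.Integer.Properties as ℤ
open import Data.Integer.Tactic.RingSolver using (solve-∀)
open import Data.List.Base as List using (List; []; _∷_; _++_; cartesianProductWith; length)
open import Data.Maybe.Base using (Maybe; map)
open import Data.Nat.Base as ℕ using (ℕ; zero; suc; pred; _!; NonZero; NonTrivial)
import Data.Nat.Properties as ℕ
open import Data.Product.Base using (_×_; _,_; ∃; ∃₂; proj₁; proj₂)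
open import Data.Rational.Base as ℚ using (ℚ; 0ℚ; 1ℚ; _/_)
import Data.Rational.Properties as ℚ
import Data.Rational.Unnormalised.Base as ℚᵘ
import Data.Rational.Unnormalised.Properties as ℚᵘ
open import Data.Sum.Base using (_⊎_; inj₁; inj₂)
open import Data.Vec.Base as Vec using (Vec; []; _∷_; lookup; replicate; _[_]≔_)
import Data.Vec.Functional as Vector
open import Data.Vec.Properties using (≡-dec)
open import Function.Base using (_∘_)
open import Relation.Binary.Consequences using (dec⇒weaklyDec)
open import Relation.Binary.PropositionalEquality as ≡ using (_≡_; _≢_)
import Relation.Binary.Reasoning.Setoid as SetoidReasoning
open import Relation.Binary.Structures using (IsStrictPartialOrder)
open import Relation.Nullary using (¬_; Dec; yes; no; contradiction)

-- The reals are axiomatic and constructive: there is no sine, no complex exponential and no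
-- trichotomy, and `cos` is any function to which the series converges, not assumed to respect `≈`.
-- So the product formula replaces roots of unity, weak inequalities are negated strict ones, and an
-- equation is proved by refuting both signs. `IsPi` yields only negated equations, so cancellation
-- has to work from `¬ x ≈ 0#` instead of an inverse. The grid has mesh π/4n for two reasons. It
-- contains π/2 for every n, odd or even, and 2πm/n arises from πm/4n by three doublings, where for
-- 0 < m < n both πm/4n and πm/2n lie in (0, π/2), the interval on which the cosine is known not to
-- vanish. The terms of the series are compared with powers of 1/8 = 2⁻³: truncating the Cauchy
-- product costs a factor N², the test for an infinitesimal costs one more factor, and N ≤ 2 ^ N
-- absorbs each of the three.

-- Evaluation of formal polynomials in a commutative ring over ℚ

module Evaluation {a ℓ} (A : CommutativeRing a ℓ) (ι : ℚ → CommutativeRing.Carrier A)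
  (ι-isHom : IsRingHomomorphism ℚ.+-*-rawRing (CommutativeRing.rawRing A) ι) where

  open CommutativeRing A hiding (zero)
  private
    module ι = IsRingHomomorphism ι-isHom
    module Π = MonoidSum *-commutativeMonoid
    module R = RawSR (RawRing.rawSemiring rawRing)
  open Exp semiring using (_^_; ^-homo-*; ^-congˡ)
  open SetoidReasoning setoid

  monomial : ∀ {m} → Vec ℕ m → (Fin m → Carrier) → Carrier
  monomial e x = R.product λ i → x i ^ lookup e i

  evaluate : ∀ {m} → MPoly m → (Fin m → Carrier) → Carrier
  evaluate p x = eval rawRing ι p x

  monomial-+ : ∀ {m} (e e′ : Vec ℕ m) x →
               monomial (Vec.zipWith ℕ._+_ e e′) x ≈ monomial e x * monomial e′ x
  monomial-+ []      []        x = sym (*-identityˡ 1#)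
  monomial-+ (k ∷ e) (k′ ∷ e′) x = begin
    x zero ^ (k ℕ.+ k′) * monomial (Vec.zipWith ℕ._+_ e e′) (λ i → x (suc i))
      ≈⟨ *-cong (^-homo-* (x zero) k k′) (monomial-+ e e′ (λ i → x (suc i))) ⟩
    (x zero ^ k * x zero ^ k′) * (_ * _)
      ≈⟨ interchange _ _ _ _ ⟩
    _ ∎
    where open import Algebra.Properties.CommutativeSemigroup *-commutativeSemigroup using (interchange)

  monomial-0 : ∀ {m} (x : Fin m → Carrier) → monomial (replicate m 0) x ≈ 1#
  monomial-0 {zero}  x = refl
  monomial-0 {suc m} x = trans (*-identityˡ _) (monomial-0 (λ i → x (suc i)))

  monomial-var : ∀ {m} (i : Fin m) x → monomial (replicate m 0 [ i ]≔ 1) x ≈ x i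
  monomial-var zero    x = trans (*-cong (*-identityʳ _) (monomial-0 (λ i → x (suc i)))) (*-identityʳ _)
  monomial-var (suc i) x = trans (*-identityˡ _) (monomial-var i (λ i → x (suc i)))

  evaluate-++ : ∀ {m} (p q : MPoly m) x → evaluate (p ++ q) x ≈ evaluate p x + evaluate q x
  evaluate-++ []      q x = sym (+-identityˡ _)
  evaluate-++ (t ∷ p) q x = trans (+-congˡ (evaluate-++ p q x)) (sym (+-assoc _ _ _))

  evaluate-mulTerm : ∀ {m} (t : ℚ × Vec ℕ m) q x →
    evaluate (List.map (mulTerm t) q) x ≈ evaluate (t ∷ []) x * evaluate q x
  evaluate-mulTerm t       []             x = sym (zeroʳ _)
  evaluate-mulTerm (c , e) ((d , e′) ∷ q) x = begin
    ι (c ℚ.* d) * monomial (Vec.zipWith ℕ._+_ e e′) x + evaluate (List.map (mulTerm (c , e)) q) x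
      ≈⟨ +-cong (*-cong (ι.*-homo c d) (monomial-+ e e′ x)) (evaluate-mulTerm (c , e) q x) ⟩
    ι c * ι d * (monomial e x * monomial e′ x) + evaluate ((c , e) ∷ []) x * evaluate q x
      ≈⟨ +-congʳ (trans (interchange _ _ _ _) (*-congʳ (sym (+-identityʳ _)))) ⟩
    evaluate ((c , e) ∷ []) x * (ι d * monomial e′ x) + evaluate ((c , e) ∷ []) x * evaluate q x
      ≈⟨ distribˡ _ _ _ ⟨
    _ ∎
    where open import Algebra.Properties.CommutativeSemigroup *-commutativeSemigroup using (interchange)

  evaluate-* : ∀ {m} (p q : MPoly m) x →
    evaluate (cartesianProductWith mulTerm p q) x ≈ evaluate p x * evaluate q x
  evaluate-* []      q x = sym (zeroˡ _)
  evaluate-* (t ∷ p) q x = begin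
    evaluate (List.map (mulTerm t) q ++ cartesianProductWith mulTerm p q) x
      ≈⟨ evaluate-++ (List.map (mulTerm t) q) _ x ⟩
    _ ≈⟨ +-cong (evaluate-mulTerm t q x) (evaluate-* p q x) ⟩
    evaluate (t ∷ []) x * evaluate q x + evaluate p x * evaluate q x
      ≈⟨ distribʳ _ _ _ ⟨
    (evaluate (t ∷ []) x + evaluate p x) * evaluate q x
      ≈⟨ *-congʳ (evaluate-++ (t ∷ []) p x) ⟨
    evaluate (t ∷ p) x * evaluate q x ∎

  evaluate-const : ∀ {m} c (x : Fin m → Carrier) → evaluate (constₚ c) x ≈ ι c
  evaluate-const c x =
    trans (+-identityʳ _) (trans (*-congˡ (monomial-0 x)) (*-identityʳ _))

  evaluate-var : ∀ {m} (i : Fin m) x → evaluate (varₚ i) x ≈ x i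
  evaluate-var i x =
    trans (+-identityʳ _) (trans (*-cong ι.1#-homo (monomial-var i x)) (*-identityˡ _))

  evaluate-1 : ∀ {m} (x : Fin m → Carrier) → evaluate (constₚ 1ℚ) x ≈ 1#
  evaluate-1 x = trans (evaluate-const 1ℚ x) ι.1#-homo

  private module Poly m = RawSR (RawRing.rawSemiring (polyRing m))

  evaluate-sum : ∀ {m k} (f : Fin k → MPoly m) x →
    evaluate (Poly.sum m f) x ≈ R.sum (λ i → evaluate (f i) x)
  evaluate-sum {k = zero}  f x = refl
  evaluate-sum {k = suc k} f x =
    trans (evaluate-++ (f zero) _ x) (+-congˡ (evaluate-sum (λ i → f (suc i)) x))

  evaluate-product : ∀ {m k} (f : Fin k → MPoly m) x →
    evaluate (Poly.product m f) x ≈ R.product (λ i → evaluate (f i) x)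
  evaluate-product {k = zero}  f x = evaluate-1 x
  evaluate-product {k = suc k} f x =
    trans (evaluate-* (f zero) _ x) (*-congˡ (evaluate-product (λ i → f (suc i)) x))

  evaluate-^ : ∀ {m} (p : MPoly m) k x → evaluate (Poly._^_ m p k) x ≈ evaluate p x ^ k
  evaluate-^ p zero    x = evaluate-1 x
  evaluate-^ p (suc k) x = trans (evaluate-* p _ x) (*-congˡ (evaluate-^ p k x))

  monomial-cong : ∀ {m} (e : Vec ℕ m) {x y} → (∀ i → x i ≈ y i) → monomial e x ≈ monomial e y
  monomial-cong e x≈y = Π.sum-cong-≋ λ i → ^-congˡ (lookup e i) (x≈y i)

  evaluate-cong : ∀ {m} (p : MPoly m) {x y} → (∀ i → x i ≈ y i) → evaluate p x ≈ evaluate p y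
  evaluate-cong []            x≈y = refl
  evaluate-cong ((c , e) ∷ p) x≈y = +-cong (*-congˡ (monomial-cong e x≈y)) (evaluate-cong p x≈y)

  -- Serves in both directions: it moves evaluation at the cosines inside `Ψ`, and it recognises `Ψ`
  -- of the affine values as the value of a single polynomial.
  evaluate-substitution : ∀ {m k} (p : MPoly k) (f : Fin k → MPoly m) x →
    evaluate (eval (polyRing m) constₚ p f) x ≈ evaluate p (λ i → evaluate (f i) x)
  evaluate-substitution     []            f x = refl
  evaluate-substitution {m} ((c , e) ∷ p) f x = begin
    evaluate (cartesianProductWith mulTerm (constₚ c) monomialₚ ++ eval (polyRing m) constₚ p f) x
      ≈⟨ evaluate-++ (cartesianProductWith mulTerm (constₚ c) monomialₚ) _ x ⟩
    _ ≈⟨ +-cong (evaluate-* (constₚ c) monomialₚ x) (evaluate-substitution p f x) ⟩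
    _ ≈⟨ +-congʳ (*-cong (evaluate-const c x) (evaluate-product powers x)) ⟩
    _ ≈⟨ +-congʳ (*-congˡ (Π.sum-cong-≋ λ i → evaluate-^ (f i) (lookup e i) x)) ⟩
    _ ∎
    where
    powers    = λ i → Poly._^_ m (f i) (lookup e i)
    monomialₚ = Poly.product m powers

  -- The value of `R∞` is computed in ℚ and then embedded; this turns it into an evaluation over the
  -- reals.
  ι-evaluate : ∀ {m} (p : MPoly m) (q : Fin m → ℚ) →
    ι (eval ℚ.+-*-rawRing (λ c → c) p q) ≈ evaluate p (λ i → ι (q i))
  ι-evaluate []            q = ι.0#-homo
  ι-evaluate ((c , e) ∷ p) q =
    trans (ι.+-homo _ _) (+-cong (trans (ι.*-homo c _) (*-congˡ (ι-monomial e q))) (ι-evaluate p q))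
    where
    module Q = RawSR (RawRing.rawSemiring ℚ.+-*-rawRing)
    ι-^ : ∀ r k → ι (r Q.^ k) ≈ ι r ^ k
    ι-^ r zero    = ι.1#-homo
    ι-^ r (suc k) = trans (ι.*-homo r _) (*-congˡ (ι-^ r k))
    ι-monomial : ∀ {m} (e : Vec ℕ m) q →
      ι (Q.product λ i → q i Q.^ lookup e i) ≈ monomial e (λ i → ι (q i))
    ι-monomial []      q = ι.1#-homo
    ι-monomial (k ∷ e) q =
      trans (ι.*-homo _ _) (*-cong (ι-^ (q zero) k) (ι-monomial e (λ i → q (suc i))))

  -- Evaluation respects ≈ₚ: all terms with a given exponent vector are collected at once,
  -- by induction on the number of terms.

  private
    _≟ᵉ_ : ∀ {m} (e e′ : Vec ℕ m) → Dec (e ≡ e′)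
    _≟ᵉ_ = ≡-dec ℕ._≟_

  remove : ∀ {m} → Vec ℕ m → MPoly m → MPoly m
  remove e []             = []
  remove e ((c , e′) ∷ p) with e′ ≟ᵉ e
  ... | yes _ = remove e p
  ... | no  _ = (c , e′) ∷ remove e p

  length-remove : ∀ {m} (e : Vec ℕ m) p → length (remove e p) ℕ.≤ length p
  length-remove e []             = ℕ.z≤n
  length-remove e ((c , e′) ∷ p) with e′ ≟ᵉ e
  ... | yes _ = ℕ.m≤n⇒m≤1+n (length-remove e p)
  ... | no  _ = ℕ.s≤s (length-remove e p)

  coeff-remove-≡ : ∀ {m} (e : Vec ℕ m) p → coeff (remove e p) e ≡ 0ℚ
  coeff-remove-≡ e []             = ≡.refl
  coeff-remove-≡ e ((c , e′) ∷ p) with e′ ≟ᵉ e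
  ... | yes _ = coeff-remove-≡ e p
  ... | no e′≢e with e′ ≟ᵉ e
  ...   | yes e′≡e = contradiction e′≡e e′≢e
  ...   | no  _    = coeff-remove-≡ e p

  coeff-remove-≢ : ∀ {m} (e f : Vec ℕ m) p → e ≢ f → coeff (remove e p) f ≡ coeff p f
  coeff-remove-≢ e f []             e≢f = ≡.refl
  coeff-remove-≢ e f ((c , e′) ∷ p) e≢f with e′ ≟ᵉ e
  coeff-remove-≢ e f ((c , e′) ∷ p) e≢f | yes e′≡e with e′ ≟ᵉ f
  ... | yes e′≡f = contradiction (≡.trans (≡.sym e′≡e) e′≡f) e≢f
  ... | no  _    = coeff-remove-≢ e f p e≢f
  coeff-remove-≢ e f ((c , e′) ∷ p) e≢f | no _ with e′ ≟ᵉ f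
  ... | yes _ = ≡.cong (c ℚ.+_) (coeff-remove-≢ e f p e≢f)
  ... | no  _ = coeff-remove-≢ e f p e≢f

  evaluate-remove : ∀ {m} (e : Vec ℕ m) p x →
    evaluate p x ≈ ι (coeff p e) * monomial e x + evaluate (remove e p) x
  evaluate-remove e []             x = sym (trans (+-identityʳ _) (trans (*-congʳ ι.0#-homo) (zeroˡ _)))
  evaluate-remove e ((c , e′) ∷ p) x with e′ ≟ᵉ e
  ... | yes ≡.refl = begin
    ι c * monomial e x + evaluate p x
      ≈⟨ +-congˡ (evaluate-remove e p x) ⟩
    ι c * monomial e x + (ι (coeff p e) * monomial e x + evaluate (remove e p) x)
      ≈⟨ +-assoc _ _ _ ⟨
    _ ≈⟨ +-congʳ (trans (*-congʳ (ι.+-homo c _)) (distribʳ _ _ _)) ⟨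
    _ ∎
  ... | no _ = trans (+-congˡ (evaluate-remove e p x)) (x∙yz≈y∙xz _ _ _)
    where open import Algebra.Properties.CommutativeSemigroup
                (CommutativeRing.+-commutativeSemigroup A) using (x∙yz≈y∙xz)

  -- The bound `n` is the induction measure, since `remove e p` is not a subterm of `p`. It is
  -- shorter because the head of `p`, having exponent `e`, is dropped.
  evaluate-null : ∀ {m} n (p : MPoly m) x → length p ℕ.≤ n →
    (∀ e → coeff p e ≡ 0ℚ) → evaluate p x ≈ 0#
  evaluate-null n       []                x _ _    = refl
  evaluate-null (suc n) p@((c , e) ∷ p′) x |p|≤1+n p≈0 = begin
    evaluate p x
      ≈⟨ evaluate-remove e p x ⟩
    ι (coeff p e) * monomial e x + evaluate (remove e p) x
      ≈⟨ +-cong (trans (*-congʳ (trans (ι.⟦⟧-cong (p≈0 e)) ι.0#-homo)) (zeroˡ _))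
                (evaluate-null n (remove e p) x shorter null) ⟩
    0# + 0# ≈⟨ +-identityˡ 0# ⟩
    0# ∎
    where
    shorter : length (remove e p) ℕ.≤ n
    shorter with e ≟ᵉ e
    ... | yes _  = ℕ.≤-trans (length-remove e p′) (ℕ.≤-pred |p|≤1+n)
    ... | no e≢e = contradiction ≡.refl e≢e
    null : ∀ f → coeff (remove e p) f ≡ 0ℚ
    null f with e ≟ᵉ f
    ... | yes ≡.refl = coeff-remove-≡ e p
    ... | no e≢f     = ≡.trans (coeff-remove-≢ e f p e≢f) (p≈0 f)

  negate : ∀ {m} → MPoly m → MPoly m
  negate {m} = RawRing.-_ (polyRing m)

  evaluate-negate : ∀ {m} (p : MPoly m) x → evaluate (negate p) x ≈ - evaluate p x
  evaluate-negate []            x = sym (RingP.-0#≈0# ring)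
  evaluate-negate ((c , e) ∷ p) x = begin
    ι (ℚ.- c) * monomial e x + evaluate (negate p) x
      ≈⟨ +-cong (*-congʳ (ι.-‿homo c)) (evaluate-negate p x) ⟩
    - ι c * monomial e x + - evaluate p x
      ≈⟨ +-congʳ (RingP.-‿distribˡ-* ring _ _) ⟨
    - (ι c * monomial e x) + - evaluate p x
      ≈⟨ RingP.-‿+-comm ring _ _ ⟩
    _ ∎

  coeff-++ : ∀ {m} (p q : MPoly m) e → coeff (p ++ q) e ≡ coeff p e ℚ.+ coeff q e
  coeff-++ []             q e = ≡.sym (ℚ.+-identityˡ _)
  coeff-++ ((c , e′) ∷ p) q e with e′ ≟ᵉ e
  ... | yes _ = ≡.trans (≡.cong (c ℚ.+_) (coeff-++ p q e)) (≡.sym (ℚ.+-assoc c _ _))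
  ... | no  _ = coeff-++ p q e

  coeff-negate : ∀ {m} (p : MPoly m) e → coeff (negate p) e ≡ ℚ.- coeff p e
  coeff-negate []             e = ≡.refl
  coeff-negate ((c , e′) ∷ p) e with e′ ≟ᵉ e
  ... | yes _ = ≡.trans (≡.cong (ℚ.- c ℚ.+_) (coeff-negate p e)) (≡.sym (ℚ.neg-distrib-+ c _))
  ... | no  _ = coeff-negate p e

  -- The terms of `p` and `q` need not correspond, as `≈ₚ` compares collected coefficients only;
  -- hence the detour through the difference, all of whose coefficients vanish.
  evaluate-respects-≈ₚ : ∀ {m} (p q : MPoly m) x → p ≈ₚ q → evaluate p x ≈ evaluate q x
  evaluate-respects-≈ₚ p q x p≈q = RingP.x∙y⁻¹≈ε⇒x≈y ring _ _ (begin
    evaluate p x + - evaluate q x        ≈⟨ +-congˡ (evaluate-negate q x) ⟨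
    evaluate p x + evaluate (negate q) x ≈⟨ evaluate-++ p (negate q) x ⟨
    evaluate (p ++ negate q) x           ≈⟨ evaluate-null _ (p ++ negate q) x ℕ.≤-refl null ⟩
    0#                                   ∎)
    where
    null : ∀ e → coeff (p ++ negate q) e ≡ 0ℚ
    null e = ≡.trans (coeff-++ p (negate q) e)
      (≡.trans (≡.cong₂ ℚ._+_ (p≈q e) (coeff-negate q e)) (ℚ.+-inverseʳ (coeff q e)))

-- Arithmetic of rational fractions

-- Normalisation by the gcd blocks computation with variable numerators, so the equation is checked
-- on unnormalised fractions, where only factors 1 are left over.
/1-homo-+ : ∀ a b → (a ℤ.+ b) ℚ./ 1 ≡ a ℚ./ 1 ℚ.+ b ℚ./ 1
/1-homo-+ a b = ℚ.toℚᵘ-injective (begin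
  ℚ.toℚᵘ ((a ℤ.+ b) ℚ./ 1)                  ≈⟨ ℚ.toℚᵘ-fromℚᵘ (ℚᵘ.mkℚᵘ (a ℤ.+ b) 0) ⟩
  ℚᵘ.mkℚᵘ (a ℤ.+ b) 0
    ≡⟨ ≡.cong₂ (λ x y → ℚᵘ.mkℚᵘ (x ℤ.+ y) 0) (ℤ.*-identityʳ a) (ℤ.*-identityʳ b) ⟨
  ℚᵘ.mkℚᵘ a 0 ℚᵘ.+ ℚᵘ.mkℚᵘ b 0
    ≈⟨ ℚᵘ.+-cong (ℚ.toℚᵘ-fromℚᵘ (ℚᵘ.mkℚᵘ a 0)) (ℚ.toℚᵘ-fromℚᵘ (ℚᵘ.mkℚᵘ b 0)) ⟨
  ℚ.toℚᵘ (a ℚ./ 1) ℚᵘ.+ ℚ.toℚᵘ (b ℚ./ 1)    ≈⟨ ℚ.toℚᵘ-homo-+ (a ℚ./ 1) (b ℚ./ 1) ⟨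
  ℚ.toℚᵘ (a ℚ./ 1 ℚ.+ b ℚ./ 1)              ∎)
  where open SetoidReasoning ℚᵘ.≃-setoid

/-* : ∀ a b n .{{_ : NonZero n}} → (a ℤ.* b) ℚ./ n ≡ a ℚ./ 1 ℚ.* (b ℚ./ n)
/-* a b n@(suc n-1) = ℚ.toℚᵘ-injective (begin
  ℚ.toℚᵘ ((a ℤ.* b) ℚ./ n)                  ≈⟨ ℚ.toℚᵘ-fromℚᵘ (ℚᵘ.mkℚᵘ (a ℤ.* b) n-1) ⟩
  ℚᵘ.mkℚᵘ (a ℤ.* b) n-1
    ≡⟨ ≡.cong (ℚᵘ.mkℚᵘ (a ℤ.* b)) (ℕ.+-identityʳ n-1) ⟨
  ℚᵘ.mkℚᵘ a 0 ℚᵘ.* ℚᵘ.mkℚᵘ b n-1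
    ≈⟨ ℚᵘ.*-cong (ℚ.toℚᵘ-fromℚᵘ (ℚᵘ.mkℚᵘ a 0)) (ℚ.toℚᵘ-fromℚᵘ (ℚᵘ.mkℚᵘ b n-1)) ⟨
  ℚ.toℚᵘ (a ℚ./ 1) ℚᵘ.* ℚ.toℚᵘ (b ℚ./ n)    ≈⟨ ℚ.toℚᵘ-homo-* (a ℚ./ 1) (b ℚ./ n) ⟨
  ℚ.toℚᵘ (a ℚ./ 1 ℚ.* (b ℚ./ n))              ∎)
  where open SetoidReasoning ℚᵘ.≃-setoid

n/n≡1 : ∀ n .{{_ : NonZero n}} → + n ℚ./ n ≡ 1ℚ
n/n≡1 n@(suc n-1) = ℚ.fromℚᵘ-cong {ℚᵘ.mkℚᵘ (+ n) n-1} {ℚᵘ.1ℚᵘ}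
  (ℚᵘ.*≡* (ℤ.*-comm (+ n) 1ℤ))

-- Constructive ordered-field arithmetic: signs, absolute bounds, infinitesimals

module RealProperties {c ℓ₁ ℓ₂} (ℝ : RealField c ℓ₁ ℓ₂) where
  open RealField ℝ public
  open IsHeytingField isHeytingField using (isCommutativeRing; #-cotrans; #⇒invertible; invertible⇒#; tight)
  private module < = IsStrictPartialOrder isStrictPartialOrder
  private module fromℚ = IsRingHomomorphism fromℚ-homomorphism

  commutativeRing : CommutativeRing c ℓ₁
  commutativeRing = record { isCommutativeRing = isCommutativeRing }

  open CommutativeRing commutativeRing public
    hiding (Carrier; _≈_; _+_; _*_; -_; 0#; 1#; _-_; rawRing; zero)
  open RingP ring public using (-‿involutive; x∙y⁻¹≈ε⇒x≈y)
  open Exp semiring public using (_^_; ^-congˡ; ^-homo-*; ^-congʳ)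

  private
    module RP = RingP ring
    module × = Mult semiring
    _×1 : ℕ → Carrier
    n ×1 = n ×.× 1#

  fromℤ : ℤ → Carrier
  fromℤ z = fromℚ (z ℚ./ 1)

  fromℕ : ℕ → Carrier
  fromℕ n = fromℤ (+ n)

  fromℤ-+ : ∀ a b → fromℤ (a ℤ.+ b) ≈ fromℤ a + fromℤ b
  fromℤ-+ a b = trans (fromℚ.⟦⟧-cong (/1-homo-+ a b)) (fromℚ.+-homo _ _)

  fromℤ-* : ∀ a b → fromℤ (a ℤ.* b) ≈ fromℤ a * fromℤ b
  fromℤ-* a b = trans (fromℚ.⟦⟧-cong (/-* a b 1)) (fromℚ.*-homo _ _)

  fromℤ-neg : ∀ a → fromℤ (ℤ.- a) ≈ - fromℤ a
  fromℤ-neg a = RP.+-inverseˡ-unique _ _ (begin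
    fromℤ (ℤ.- a) + fromℤ a ≈⟨ fromℤ-+ (ℤ.- a) a ⟨
    fromℤ (ℤ.- a ℤ.+ a)     ≡⟨ ≡.cong fromℤ (ℤ.+-inverseˡ a) ⟩
    fromℤ 0ℤ                ≈⟨ fromℚ.0#-homo ⟩
    0#                      ∎)
    where open SetoidReasoning setoid

  fromℕ-suc : ∀ n → fromℕ (suc n) ≈ 1# + fromℕ n
  fromℕ-suc n = trans (fromℤ-+ 1ℤ (+ n)) (+-congʳ fromℚ.1#-homo)

  fromℚ-/ : ∀ z n .{{_ : NonZero n}} → fromℚ (z ℚ./ n) ≈ fromℤ z * fromℚ (1ℤ ℚ./ n)
  fromℚ-/ z n = trans
    (fromℚ.⟦⟧-cong (≡.trans (≡.cong (λ y → y ℚ./ n) (≡.sym (ℤ.*-identityʳ z))) (/-* z 1ℤ n)))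
    (fromℚ.*-homo _ _)

  n*1/n≈1 : ∀ n .{{_ : NonZero n}} → fromℕ n * fromℚ (1ℤ ℚ./ n) ≈ 1#
  n*1/n≈1 n = trans (sym (fromℚ-/ (+ n) n)) (trans (fromℚ.⟦⟧-cong (n/n≡1 n)) fromℚ.1#-homo)

  -- The coefficients of the ring solver: small integers reduce to sums of 1#.

  private
    ⟦_⟧ : ℤ → Carrier
    ⟦ + n ⟧      = n ×1
    ⟦ -[1+ n ] ⟧ = - (suc n ×1)

    fromℕ≈×1 : ∀ n → fromℕ n ≈ n ×1
    fromℕ≈×1 zero    = fromℚ.0#-homo
    fromℕ≈×1 (suc n) = trans (fromℕ-suc n) (trans (+-congˡ (fromℕ≈×1 n)) (sym (×.1+× n 1#)))

    fromℤ≈⟦⟧ : ∀ z → fromℤ z ≈ ⟦ z ⟧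
    fromℤ≈⟦⟧ (+ n)      = fromℕ≈×1 n
    fromℤ≈⟦⟧ -[1+ n ]   = trans (fromℤ-neg (+ suc n)) (-‿cong (fromℕ≈×1 (suc n)))

    morphism : ℤ.+-*-rawRing ACR.-Raw-AlmostCommutative⟶ ACR.fromCommutativeRing commutativeRing
    morphism = record
      { ⟦_⟧    = ⟦_⟧
      ; +-homo = λ a b → trans (sym (fromℤ≈⟦⟧ (a ℤ.+ b)))
                   (trans (fromℤ-+ a b) (+-cong (fromℤ≈⟦⟧ a) (fromℤ≈⟦⟧ b)))
      ; *-homo = λ a b → trans (sym (fromℤ≈⟦⟧ (a ℤ.* b)))
                   (trans (fromℤ-* a b) (*-cong (fromℤ≈⟦⟧ a) (fromℤ≈⟦⟧ b)))
      ; -‿homo = λ a → trans (sym (fromℤ≈⟦⟧ (ℤ.- a)))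
                   (trans (fromℤ-neg a) (-‿cong (fromℤ≈⟦⟧ a)))
      ; 0-homo = refl
      ; 1-homo = refl
      }

    ⟦⟧-weaklyDecidable : ∀ a b → Maybe (⟦ a ⟧ ≈ ⟦ b ⟧)
    ⟦⟧-weaklyDecidable a b = map (λ a≡b → reflexive (≡.cong ⟦_⟧ a≡b)) (dec⇒weaklyDec ℤ._≟_ a b)

  open RingSolver ℤ.+-*-rawRing (ACR.fromCommutativeRing commutativeRing) morphism ⟦⟧-weaklyDecidable public
    using (solve; con; _:=_; _:+_; _:*_; _:-_; :-_)

  -- In this form it is definitionally what the solver reads from `con 1ℤ :+ con 1ℤ`.
  2# : Carrier
  2# = 1# + 1#

  fromℕ-0 : fromℕ 0 ≈ 0#
  fromℕ-0 = fromℚ.0#-homo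

  fromℕ-1 : fromℕ 1 ≈ 1#
  fromℕ-1 = fromℚ.1#-homo

  fromℕ-+ : ∀ m n → fromℕ (m ℕ.+ n) ≈ fromℕ m + fromℕ n
  fromℕ-+ m n = fromℤ-+ (+ m) (+ n)

  fromℕ-* : ∀ m n → fromℕ (m ℕ.* n) ≈ fromℕ m * fromℕ n
  fromℕ-* m n = trans (reflexive (≡.cong fromℤ (ℤ.pos-* m n))) (fromℤ-* (+ m) (+ n))

  fromℕ-^ : ∀ m k → fromℕ (m ℕ.^ k) ≈ fromℕ m ^ k
  fromℕ-^ m zero    = fromℕ-1
  fromℕ-^ m (suc k) = trans (fromℕ-* m (m ℕ.^ k)) (*-congˡ (fromℕ-^ m k))

  -- Signs

  private
    ₀⟶ : ∀ {x y} → x < y → x - y < 0#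
    ₀⟶ {x} {y} x<y = <.<-respʳ-≈ (-‿inverseʳ y) (+-monoˡ-< (- y) x<y)

  <-respˡ : ∀ {x y z} → x ≈ y → x < z → y < z
  <-respˡ = <.<-respˡ-≈

  <-respʳ : ∀ {x y z} → x ≈ y → z < x → z < y
  <-respʳ = <.<-respʳ-≈

  <-trans : ∀ {x y z} → x < y → y < z → x < z
  <-trans = <.trans

  <-irrefl : ∀ {x y} → x ≈ y → ¬ x < y
  <-irrefl = <.irrefl

  x<0⇒0<-x : ∀ {x} → x < 0# → 0# < - x
  x<0⇒0<-x {x} x<0 = <-respˡ (-‿inverseʳ x) (<-respʳ (+-identityˡ (- x)) (+-monoˡ-< (- x) x<0))

  0<x⇒-x<0 : ∀ {x} → 0# < x → - x < 0#
  0<x⇒-x<0 {x} 0<x = <-respˡ (+-identityˡ (- x)) (<-respʳ (-‿inverseʳ x) (+-monoˡ-< (- x) 0<x))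

  0<-x⇒x<0 : ∀ {x} → 0# < - x → x < 0#
  0<-x⇒x<0 {x} 0<-x = <-respˡ (-‿involutive x) (0<x⇒-x<0 0<-x)

  -- Apartness is tight, so equations may be proved by case distinction.
  ≈-by-cases : ∀ {x} → ¬ x < 0# → ¬ 0# < x → x ≈ 0#
  ≈-by-cases x≮0 0≮x = proj₁ (tight _ _) λ where
    (inj₁ x<0) → x≮0 x<0
    (inj₂ 0<x) → 0≮x 0<x

  private
    invertible : ∀ {x} → x < 0# ⊎ 0# < x → ∃ λ y → y * x ≈ 1#
    invertible {x} x#0 with #⇒invertible x#0
    ... | y , yx≈1 , _ = y , trans (*-congˡ (solve 1 (λ x → x := x :- con 0ℤ) refl x)) yx≈1

    leftInverse⇒# : ∀ {x} y → y * x ≈ 1# → x < 0# ⊎ 0# < x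
    leftInverse⇒# {x} y yx≈1 = invertible⇒# (y , eq , trans (*-comm _ _) eq)
      where
      eq : y * (x - 0#) ≈ 1#
      eq = trans (*-congˡ (solve 1 (λ x → x :- con 0ℤ := x) refl x)) yx≈1

  -- The hypothesis on `x` does not provide an inverse of it, so `y` is inverted instead: if `y`
  -- were apart from 0, then `x * y ≈ 0#` would force `x ≈ 0#`.
  *-cancel-0 : ∀ {x y} → ¬ x ≈ 0# → x * y ≈ 0# → y ≈ 0#
  *-cancel-0 {x} {y} x≉0 xy≈0 = ≈-by-cases (λ y<0 → absurd (inj₁ y<0)) (λ 0<y → absurd (inj₂ 0<y))
    where
    absurd : ¬ (y < 0# ⊎ 0# < y)
    absurd y#0 with invertible y#0
    ... | z , zy≈1 = x≉0 (begin
      x           ≈⟨ *-identityʳ x ⟨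
      x * 1#      ≈⟨ *-congˡ zy≈1 ⟨
      x * (z * y) ≈⟨ solve 3 (λ x y z → x :* (z :* y) := z :* (x :* y)) refl x y z ⟩
      z * (x * y) ≈⟨ *-congˡ xy≈0 ⟩
      z * 0#      ≈⟨ zeroʳ z ⟩
      0#          ∎)
      where open SetoidReasoning setoid

  -- Being its own inverse, 1 is apart from 0. The alternative 1 < 0 leads to the claim as well,
  -- because then 1 = (-1)² is a product of positive numbers.
  0<1 : 0# < 1#
  0<1 with leftInverse⇒# {1#} 1# (*-identityˡ 1#)
  ... | inj₂ 0<1 = 0<1
  ... | inj₁ 1<0 = <-respʳ (solve 0 (:- con 1ℤ :* :- con 1ℤ := con 1ℤ) refl)
                     (*-pos (x<0⇒0<-x 1<0) (x<0⇒0<-x 1<0))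

  -- The weak order as a negation: it needs no decision between < and ≈, and together with tightness
  -- it still determines equality.
  NonNeg : Carrier → Set ℓ₂
  NonNeg x = ¬ x < 0#

  pos⇒nonNeg : ∀ {x} → 0# < x → NonNeg x
  pos⇒nonNeg 0<x x<0 = <-irrefl refl (<-trans 0<x x<0)

  nonNeg-resp : ∀ {x y} → x ≈ y → NonNeg x → NonNeg y
  nonNeg-resp x≈y x≮0 y<0 = x≮0 (<-respˡ (sym x≈y) y<0)

  nonNeg-0 : NonNeg 0#
  nonNeg-0 = <-irrefl refl

  -- Cotransitivity of `x + y < 0#` at `y` makes either `y` apart from `x + y`, which gives `x` a
  -- sign, or `y` apart from 0; each sign is contradictory.
  nonNeg-+ : ∀ {x y} → NonNeg x → NonNeg y → NonNeg (x + y)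
  nonNeg-+ {x} {y} x≮0 y≮0 x+y<0 with #-cotrans (inj₁ x+y<0) y
  ... | inj₂ (inj₁ y<0) = y≮0 y<0
  ... | inj₂ (inj₂ 0<y) =
    x≮0 (<-trans (<-respˡ (+-identityˡ x) (<-respʳ (+-comm y x) (+-monoˡ-< x 0<y))) x+y<0)
  ... | inj₁ (inj₁ x+y<y) = x≮0 (<-respˡ (solve 2 (λ x y → x :+ y :- y := x) refl x y) (₀⟶ x+y<y))
  ... | inj₁ (inj₂ y<x+y) = y≮0 (<-trans y<x+y x+y<0)

  -- A negative product is invertible, so both factors are invertible and have a sign; two positive
  -- factors cannot have a negative product.
  nonNeg-* : ∀ {x y} → NonNeg x → NonNeg y → NonNeg (x * y)
  nonNeg-* {x} {y} x≮0 y≮0 xy<0 with invertible (inj₁ xy<0)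
  ... | z , zxy≈1
    with leftInverse⇒# (z * y) (trans (solve 3 (λ x y z → z :* y :* x := z :* (x :* y)) refl x y z) zxy≈1)
       | leftInverse⇒# (z * x) (trans (*-assoc z x y) zxy≈1)
  ... | inj₁ x<0 | _        = x≮0 x<0
  ... | _        | inj₁ y<0 = y≮0 y<0
  ... | inj₂ 0<x | inj₂ 0<y = pos⇒nonNeg (*-pos 0<x 0<y) xy<0

  nonNeg-half : ∀ {x} → NonNeg (x + x) → NonNeg x
  nonNeg-half {x} 2x≮0 x<0 =
    2x≮0 (<-trans (<-respʳ (+-identityˡ x) (+-monoˡ-< x x<0)) x<0)

  nonNeg-fromℕ : ∀ n → NonNeg (fromℕ n)
  nonNeg-fromℕ zero    = nonNeg-resp (sym fromℕ-0) nonNeg-0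
  nonNeg-fromℕ (suc n) =
    nonNeg-resp (sym (fromℕ-suc n)) (nonNeg-+ (pos⇒nonNeg 0<1) (nonNeg-fromℕ n))

  fromℕ-pos : ∀ n .{{_ : NonZero n}} → 0# < fromℕ n
  fromℕ-pos (suc zero)      = <-respʳ (sym fromℕ-1) 0<1
  fromℕ-pos (suc n@(suc _)) = <-trans 0<1
    (<-respˡ (+-identityˡ 1#)
      (<-respʳ (trans (+-comm _ 1#) (sym (fromℕ-suc n))) (+-monoˡ-< 1# (fromℕ-pos n))))

  fromℕ-mono : ∀ {m n} → m ℕ.≤ n → NonNeg (fromℕ n - fromℕ m)
  fromℕ-mono {m} m≤n with ℕ.m≤n⇒∃[o]m+o≡n m≤n
  ... | k , ≡.refl = nonNeg-resp
    (trans (solve 2 (λ m k → k := m :+ k :- m) refl (fromℕ m) (fromℕ k)) (+-congʳ (sym (fromℕ-+ m k))))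
    (nonNeg-fromℕ k)

  1/n-pos : ∀ n .{{_ : NonZero n}} → 0# < fromℚ (1ℤ ℚ./ n)
  1/n-pos n with leftInverse⇒# (fromℕ n) (n*1/n≈1 n)
  ... | inj₂ 0<1/n = 0<1/n
  ... | inj₁ 1/n<0 = contradiction
    (0<-x⇒x<0 (<-respʳ
      (trans (solve 2 (λ n w → n :* :- w := :- (n :* w)) refl (fromℕ n) _) (-‿cong (n*1/n≈1 n)))
      (*-pos (fromℕ-pos n) (x<0⇒0<-x 1/n<0))))
    (pos⇒nonNeg 0<1)

  fromℕ≉0 : ∀ n .{{_ : NonZero n}} → ¬ fromℕ n ≈ 0#
  fromℕ≉0 n n≈0 = <-irrefl (sym n≈0) (fromℕ-pos n)

  *-cancelˡ : ∀ {x y z} → ¬ x ≈ 0# → x * y ≈ x * z → y ≈ z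
  *-cancelˡ {x} {y} {z} x≉0 xy≈xz = x∙y⁻¹≈ε⇒x≈y y z (*-cancel-0 x≉0
    (trans (solve 3 (λ x y z → x :* (y :- z) := x :* y :- x :* z) refl x y z)
      (trans (+-congʳ xy≈xz) (-‿inverseʳ _))))

  2≉0 : ¬ 2# ≈ 0#
  2≉0 2≈0 = fromℕ≉0 2 (trans (fromℕ≈×1 2) 2≈0)

  -- ∣ x ∣ ≤ b

  infix 4 _≼_
  _≼_ : Carrier → Carrier → Set ℓ₂
  x ≼ b = NonNeg (b - x) × NonNeg (b + x)

  ≼-resp : ∀ {x y b c} → x ≈ y → b ≈ c → x ≼ b → y ≼ c
  ≼-resp x≈y b≈c (p , q) =
    nonNeg-resp (+-cong b≈c (-‿cong x≈y)) p , nonNeg-resp (+-cong b≈c x≈y) q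

  ≼-+ : ∀ {x y b c} → x ≼ b → y ≼ c → x + y ≼ b + c
  ≼-+ {x} {y} {b} {c} (p , q) (p′ , q′) =
    nonNeg-resp (solve 4 (λ x y b c → b :- x :+ (c :- y) := b :+ c :- (x :+ y)) refl x y b c) (nonNeg-+ p p′) ,
    nonNeg-resp (solve 4 (λ x y b c → b :+ x :+ (c :+ y) := b :+ c :+ (x :+ y)) refl x y b c) (nonNeg-+ q q′)

  -- Twice `b * c - x * y` equals `(b - x) * (c + y) + (b + x) * (c - y)`, and similarly for
  -- `b * c + x * y`, so the signs of `x` and `y` are never examined.
  ≼-* : ∀ {x y b c} → x ≼ b → y ≼ c → x * y ≼ b * c
  ≼-* {x} {y} {b} {c} (p , q) (p′ , q′) =
    nonNeg-half (nonNeg-resp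
      (solve 4 (λ x y b c → (b :- x) :* (c :+ y) :+ (b :+ x) :* (c :- y)
                         := b :* c :- x :* y :+ (b :* c :- x :* y)) refl x y b c)
      (nonNeg-+ (nonNeg-* p q′) (nonNeg-* q p′))) ,
    nonNeg-half (nonNeg-resp
      (solve 4 (λ x y b c → (b :+ x) :* (c :+ y) :+ (b :- x) :* (c :- y)
                         := b :* c :+ x :* y :+ (b :* c :+ x :* y)) refl x y b c)
      (nonNeg-+ (nonNeg-* q q′) (nonNeg-* p p′)))

  ≼-neg : ∀ {x b} → x ≼ b → - x ≼ b
  ≼-neg {x} {b} (p , q) =
    nonNeg-resp (solve 2 (λ x b → b :+ x := b :- :- x) refl x b) q , p

  ≼-weaken : ∀ {x b c} → x ≼ b → NonNeg (c - b) → x ≼ c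
  ≼-weaken {x} {b} {c} (p , q) r =
    nonNeg-resp (solve 3 (λ x b c → b :- x :+ (c :- b) := c :- x) refl x b c) (nonNeg-+ p r) ,
    nonNeg-resp (solve 3 (λ x b c → b :+ x :+ (c :- b) := c :+ x) refl x b c) (nonNeg-+ q r)

  nonNeg⇒≼ : ∀ {x} → NonNeg x → x ≼ x
  nonNeg⇒≼ {x} x≮0 = nonNeg-resp (sym (-‿inverseʳ x)) nonNeg-0 , nonNeg-+ x≮0 x≮0

  0≼ : ∀ {b} → NonNeg b → 0# ≼ b
  0≼ {b} b≮0 = nonNeg-resp (solve 1 (λ b → b := b :- con 0ℤ) refl b) b≮0 ,
               nonNeg-resp (sym (+-identityʳ b)) b≮0

  ≼-^ : ∀ {x b} k → x ≼ b → x ^ k ≼ b ^ k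
  ≼-^ zero    x≼b = nonNeg⇒≼ (pos⇒nonNeg 0<1)
  ≼-^ (suc k) x≼b = ≼-* x≼b (≼-^ k x≼b)

  within⇒≼ : ∀ {x l ε} → x within ε of l → x - l ≼ ε
  within⇒≼ {x} {l} {ε} (l-ε<x , x<l+ε) =
    (λ lt → <-irrefl refl (<-trans x<l+ε (<-respˡ (solve 3 (λ x l ε → ε :- (x :- l) :+ (x) := l :+ ε) refl x l ε)
        (<-respʳ (+-identityˡ x) (+-monoˡ-< x lt))))) ,
    (λ lt → <-irrefl refl (<-trans l-ε<x (<-respˡ (solve 3 (λ x l ε → ε :+ (x :- l) :+ (l :- ε) := x) refl x l ε)
        (<-respʳ (+-identityˡ (l - ε)) (+-monoˡ-< (l - ε) lt)))))

  -- `archimedean` bounds `x` and `- x` from above separately; the sum of the two naturals dominates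
  -- both.
  bounded : ∀ x → ∃ λ n → x ≼ fromℕ n
  bounded x with archimedean x | archimedean (- x)
  ... | m , x<m | n , -x<n = m ℕ.+ n ,
    nonNeg-resp (trans (solve 3 (λ x m n → m :- x :+ n := m :+ n :- x) refl x (fromℕ m) (fromℕ n))
                  (+-congʳ (sym (fromℕ-+ m n))))
      (nonNeg-+ (λ lt → <-irrefl refl (<-trans x<m
                   (<-respˡ (solve 2 (λ x m → m :- x :+ x := m) refl x (fromℕ m))
                     (<-respʳ (+-identityˡ x) (+-monoˡ-< x lt)))))
                (nonNeg-fromℕ n)) ,
    nonNeg-resp (trans (solve 3 (λ x m n → n :+ x :+ m := m :+ n :+ x) refl x (fromℕ m) (fromℕ n))
                  (+-congʳ (sym (fromℕ-+ m n))))
      (nonNeg-+ (λ lt → <-irrefl refl (<-trans -x<n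
                   (<-respˡ (solve 2 (λ x n → n :+ x :- x := n) refl x (fromℕ n))
                     (<-respʳ (+-identityˡ (- x)) (+-monoˡ-< (- x) lt)))))
                (nonNeg-fromℕ m))

  -- The Archimedean axiom in the form that turns error estimates into equations. If `y` is positive
  -- with inverse `z`, some natural number `n` exceeds `b * z`, and then `n * y` exceeds `b`.
  infinitesimal : ∀ {x} b → (∀ n → fromℕ (suc n) * x ≼ b) → x ≈ 0#
  infinitesimal {x} b nx≼b = ≈-by-cases
    (λ x<0 → absurd (- x) (x<0⇒0<-x x<0) λ n →
      ≼-resp (solve 2 (λ n x → :- (n :* x) := n :* :- x) refl _ x) refl (≼-neg (nx≼b n)))
    (λ 0<x → absurd x 0<x nx≼b)
    where
    absurd : ∀ y → 0# < y → (∀ n → fromℕ (suc n) * y ≼ b) → ⊥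
    absurd y 0<y ny≼b with invertible (inj₂ 0<y)
    ... | z , zy≈1 with archimedean (b * z)
    ...   | n , bz<n = proj₁ (ny≼b n) (0<-x⇒x<0 (<-respʳ eq (<-trans 0<y (<-respˡ (+-identityˡ y) (+-monoˡ-< y pos)))))
      where
      pos : 0# < (fromℕ n - b * z) * y
      pos = *-pos (<-respˡ (-‿inverseʳ _) (+-monoˡ-< (- (b * z)) bz<n)) 0<y
      eq : (fromℕ n - b * z) * y + y ≈ - (b - fromℕ (suc n) * y)
      eq = begin
        (fromℕ n - b * z) * y + y
          ≈⟨ solve 4 (λ n b z y → (n :- b :* z) :* y :+ y := (con 1ℤ :+ n) :* y :- b :* (z :* y)) refl (fromℕ n) b z y ⟩
        (1# + fromℕ n) * y - b * (z * y)
          ≈⟨ +-cong (*-congʳ (sym (fromℕ-suc n))) (-‿cong (trans (*-congˡ zy≈1) (*-identityʳ b))) ⟩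
        fromℕ (suc n) * y - b
          ≈⟨ solve 2 (λ u b → u :- b := :- (b :- u)) refl _ b ⟩
        - (b - fromℕ (suc n) * y) ∎
        where open SetoidReasoning setoid

-- Growth of powers and factorials

-- Unlike `2 ℕ.* n`, this releases two successors at a time, in step with the recursions of `conv`,
-- `_^_` and `_!`.
double : ℕ → ℕ
double zero    = zero
double (suc n) = suc (suc (double n))

2*n≡double : ∀ n → 2 ℕ.* n ≡ double n
2*n≡double zero    = ≡.refl
2*n≡double (suc n) = ≡.cong suc (≡.trans (ℕ.+-suc n (n ℕ.+ 0)) (≡.cong suc (2*n≡double n)))

n≤2^n : ∀ n → n ℕ.≤ 2 ℕ.^ n
n≤2^n zero    = ℕ.z≤n
n≤2^n (suc n) = ℕ.+-mono-≤ (ℕ.m^n>0 2 n) (ℕ.≤-trans (n≤2^n n) (ℕ.m≤m+n _ 0))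

-- The base 8 is 2³, so the cube of `n ≤ 2 ^ n` suffices.
n³≤8^n : ∀ n → n ℕ.* (n ℕ.* n) ℕ.≤ 8 ℕ.^ n
n³≤8^n n = begin
  n ℕ.* (n ℕ.* n)                     ≤⟨ ℕ.*-mono-≤ n≤ (ℕ.*-mono-≤ n≤ n≤) ⟩
  2 ℕ.^ n ℕ.* (2 ℕ.^ n ℕ.* 2 ℕ.^ n)  ≡⟨ ≡.cong (λ z → 2 ℕ.^ n ℕ.* (2 ℕ.^ n ℕ.* z)) (ℕ.*-identityʳ _) ⟨
  (2 ℕ.^ n) ℕ.^ 3                     ≡⟨ ℕ.^-*-assoc 2 n 3 ⟩
  2 ℕ.^ (n ℕ.* 3)                     ≡⟨ ≡.cong (2 ℕ.^_) (ℕ.*-comm n 3) ⟩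
  2 ℕ.^ (3 ℕ.* n)                     ≡⟨ ℕ.^-*-assoc 2 3 n ⟨
  8 ℕ.^ n                             ∎
  where
  n≤ = n≤2^n n
  open ℕ.≤-Reasoning

-- Up to exponent `m` the factor `m ^ m` is enough; afterwards each step multiplies the left side by
-- `m` and the right side by a number at least `m`.
m^n≤m^m*n! : ∀ m .{{_ : NonZero m}} n → m ℕ.^ n ℕ.≤ m ℕ.^ m ℕ.* n !
m^n≤m^m*n! m zero    = ℕ.≤-trans (ℕ.m^n>0 m m) (ℕ.m≤m*n _ 1)
m^n≤m^m*n! m (suc n) with ℕ.≤-total (suc n) m
... | inj₁ 1+n≤m = ℕ.≤-trans (ℕ.^-monoʳ-≤ m 1+n≤m) (ℕ.m≤m*n _ (suc n !) {{suc n ℕ.!≢0}})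
... | inj₂ m≤1+n = begin
  m ℕ.* m ℕ.^ n                   ≤⟨ ℕ.*-mono-≤ m≤1+n (m^n≤m^m*n! m n) ⟩
  suc n ℕ.* (m ℕ.^ m ℕ.* n !)     ≡⟨ x∙yz≈y∙xz (suc n) (m ℕ.^ m) (n !) ⟩
  m ℕ.^ m ℕ.* suc n !             ∎
  where
  open ℕ.≤-Reasoning
  open import Algebra.Properties.CommutativeSemigroup ℕ.*-commutativeSemigroup using (x∙yz≈y∙xz)

^-distrib-* : ∀ m n k → (m ℕ.* n) ℕ.^ k ≡ m ℕ.^ k ℕ.* n ℕ.^ k
^-distrib-* m n zero    = ≡.refl
^-distrib-* m n (suc k) = ≡.trans (≡.cong (m ℕ.* n ℕ.*_) (^-distrib-* m n k)) (interchange m n _ _)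
  where open import Algebra.Properties.CommutativeSemigroup ℕ.*-commutativeSemigroup using (interchange)

!-double : ∀ n → n ! ℕ.≤ double n !
!-double zero    = ℕ.≤-refl
!-double (suc n) = ℕ.*-mono-≤ {suc n} {suc (suc (double n))} (ℕ.s≤s (ℕ.m≤n⇒m≤1+n (n≤double n)))
  (ℕ.≤-trans (!-double n) (ℕ.m≤n*m _ (suc (double n))))
  where
  n≤double : ∀ n → n ℕ.≤ double n
  n≤double zero    = ℕ.z≤n
  n≤double (suc n) = ℕ.s≤s (ℕ.m≤n⇒m≤1+n (n≤double n))

-- Eᵏ ≤ Eᴱ k!, with 8 b² < E
8^k*b^double≤K*double! : ∀ b → ∃ λ K → ∀ k → 8 ℕ.^ k ℕ.* b ℕ.^ double k ℕ.≤ K ℕ.* double k !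
8^k*b^double≤K*double! b = E ℕ.^ E , λ k → begin
  8 ℕ.^ k ℕ.* b ℕ.^ double k     ≡⟨ ≡.cong (8 ℕ.^ k ℕ.*_) (b^double k) ⟩
  8 ℕ.^ k ℕ.* (b ℕ.* b) ℕ.^ k    ≡⟨ ^-distrib-* 8 (b ℕ.* b) k ⟨
  (8 ℕ.* (b ℕ.* b)) ℕ.^ k        ≤⟨ ℕ.^-monoˡ-≤ k (ℕ.n≤1+n _) ⟩
  E ℕ.^ k                        ≤⟨ m^n≤m^m*n! E k ⟩
  E ℕ.^ E ℕ.* k !                ≤⟨ ℕ.*-monoʳ-≤ (E ℕ.^ E) (!-double k) ⟩
  E ℕ.^ E ℕ.* double k !         ∎
  where
  open ℕ.≤-Reasoning
  E = suc (8 ℕ.* (b ℕ.* b))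
  b^double : ∀ k → b ℕ.^ double k ≡ (b ℕ.* b) ℕ.^ k
  b^double zero    = ≡.refl
  b^double (suc k) = ≡.trans (≡.cong (λ z → b ℕ.* (b ℕ.* z)) (b^double k)) (≡.sym (ℕ.*-assoc b b _))

-- The cosine series and its Cauchy product

module CosineProduct {c ℓ₁ ℓ₂} (ℝ : RealField c ℓ₁ ℓ₂) where
  open RealProperties ℝ
  open Sum semiring using (sum-cong-≋; ∑-distrib-+; *-distribˡ-sum)
  open SetoidReasoning setoid
  private
    module SR = RawSR (RawRing.rawSemiring rawRing)

  S : (ℕ → Carrier) → ℕ → Carrier
  S f n = SR.sum {n} λ i → f (toℕ i)

  S-cong : ∀ {f g} → (∀ k → f k ≈ g k) → ∀ n → S f n ≈ S g n
  S-cong f≈g n = sum-cong-≋ {n} λ i → f≈g (toℕ i)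

  S-+ : ∀ f g n → S (λ k → f k + g k) n ≈ S f n + S g n
  S-+ f g n = ∑-distrib-+ {n} (λ i → f (toℕ i)) (λ i → g (toℕ i))

  S-* : ∀ a f n → S (λ k → a * f k) n ≈ a * S f n
  S-* a f n = sym (*-distribˡ-sum {n} a (λ i → f (toℕ i)))

  S-last : ∀ f n → S f (suc n) ≈ S f n + f n
  S-last f zero    = +-comm _ _
  S-last f (suc n) = trans (+-congˡ (S-last (f ∘ suc) n)) (sym (+-assoc _ _ _))

  -- The coefficient of index n in the Cauchy product, Σ f i * g j over i + j = n.
  conv : (f g : ℕ → Carrier) → ℕ → Carrier
  conv f g zero    = f 0 * g 0
  conv f g (suc n) = f 0 * g (suc n) + conv (f ∘ suc) g n

  conv-cong : ∀ {f f′ g g′} → (∀ i → f i ≈ f′ i) → (∀ j → g j ≈ g′ j) →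
              ∀ n → conv f g n ≈ conv f′ g′ n
  conv-cong f≈ g≈ zero    = *-cong (f≈ 0) (g≈ 0)
  conv-cong f≈ g≈ (suc n) = +-cong (*-cong (f≈ 0) (g≈ (suc n))) (conv-cong (f≈ ∘ suc) g≈ n)

  conv-sucʳ : ∀ f g n → conv f g (suc n) ≈ conv f (g ∘ suc) n + f (suc n) * g 0
  conv-sucʳ f g zero    = refl
  conv-sucʳ f g (suc n) = trans (+-congˡ (conv-sucʳ (f ∘ suc) g n)) (sym (+-assoc _ _ _))

  conv-*ˡ : ∀ a f g n → conv (λ i → a * f i) g n ≈ a * conv f g n
  conv-*ˡ a f g zero    = *-assoc _ _ _
  conv-*ˡ a f g (suc n) =
    trans (+-cong (*-assoc _ _ _) (conv-*ˡ a (f ∘ suc) g n)) (sym (distribˡ _ _ _))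

  conv-*ʳ : ∀ a f g n → conv f (λ j → a * g j) n ≈ a * conv f g n
  conv-*ʳ a f g zero    = solve 3 (λ a x y → x :* (a :* y) := a :* (x :* y)) refl a _ _
  conv-*ʳ a f g (suc n) = trans (+-congˡ (conv-*ʳ a (f ∘ suc) g n))
    (solve 4 (λ a x y z → x :* (a :* y) :+ a :* z := a :* (x :* y :+ z)) refl a _ _ _)

  conv-+ʳ : ∀ f g h n → conv f (λ j → g j + h j) n ≈ conv f g n + conv f h n
  conv-+ʳ f g h zero    = distribˡ _ _ _
  conv-+ʳ f g h (suc n) = trans (+-congˡ (conv-+ʳ (f ∘ suc) g h n))
    (solve 5 (λ x y z u v → x :* (y :+ z) :+ (u :+ v) := x :* y :+ u :+ (x :* z :+ v)) refl _ _ _ _ _)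

  -- i + j = n on each summand
  conv-leibniz : ∀ a f g n →
    conv (λ i → fromℕ (a ℕ.+ i) * f i) g n + conv f (λ j → fromℕ j * g j) n
      ≈ fromℕ (a ℕ.+ n) * conv f g n
  conv-leibniz a f g zero    = begin
    fromℕ (a ℕ.+ 0) * f 0 * g 0 + f 0 * (fromℕ 0 * g 0)
      ≈⟨ +-congˡ (*-congˡ (*-congʳ fromℕ-0)) ⟩
    fromℕ (a ℕ.+ 0) * f 0 * g 0 + f 0 * (0# * g 0)
      ≈⟨ solve 3 (λ a x y → a :* x :* y :+ x :* (con 0ℤ :* y) := a :* (x :* y)) refl _ _ _ ⟩
    fromℕ (a ℕ.+ 0) * (f 0 * g 0) ∎
  conv-leibniz a f g (suc n) = begin
    fromℕ (a ℕ.+ 0) * f 0 * g (suc n) + conv (λ i → fromℕ (a ℕ.+ suc i) * f (suc i)) g n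
      + (f 0 * (fromℕ (suc n) * g (suc n)) + conv (f ∘ suc) (λ j → fromℕ j * g j) n)
      ≈⟨ solve 6 (λ a x y u b v → a :* x :* y :+ u :+ (x :* (b :* y) :+ v)
                               := (a :+ b) :* (x :* y) :+ (u :+ v)) refl _ _ _ _ _ _ ⟩
    (fromℕ (a ℕ.+ 0) + fromℕ (suc n)) * (f 0 * g (suc n))
      + (conv (λ i → fromℕ (a ℕ.+ suc i) * f (suc i)) g n + conv (f ∘ suc) (λ j → fromℕ j * g j) n)
      ≈⟨ +-cong (*-congʳ (trans (sym (fromℕ-+ (a ℕ.+ 0) (suc n))) (fromℕ-≡ (≡.cong (ℕ._+ suc n) (ℕ.+-identityʳ a)))))
          (+-congʳ (conv-cong (λ i → *-congʳ (fromℕ-≡ (ℕ.+-suc a i))) (λ _ → refl) n)) ⟩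
    fromℕ (a ℕ.+ suc n) * (f 0 * g (suc n))
      + (conv (λ i → fromℕ (suc a ℕ.+ i) * f (suc i)) g n + conv (f ∘ suc) (λ j → fromℕ j * g j) n)
      ≈⟨ +-congˡ (conv-leibniz (suc a) (f ∘ suc) g n) ⟩
    fromℕ (a ℕ.+ suc n) * (f 0 * g (suc n)) + fromℕ (suc a ℕ.+ n) * conv (f ∘ suc) g n
      ≈⟨ +-congˡ (*-congʳ (fromℕ-≡ (≡.sym (ℕ.+-suc a n)))) ⟩
    _ ≈⟨ distribˡ _ _ _ ⟨
    fromℕ (a ℕ.+ suc n) * conv f g (suc n) ∎
    where
    fromℕ-≡ : ∀ {m n} → m ≡ n → fromℕ m ≈ fromℕ n
    fromℕ-≡ m≡n = reflexive (≡.cong fromℕ m≡n)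

  -- If i + j is even, then i and j have the same parity; so it is enough that `g` vanishes at odd
  -- indices.
  conv-even : ∀ f g n → (∀ j → g (suc (double j)) ≈ 0#) →
    conv f g (double n) ≈ conv (f ∘ double) (g ∘ double) n
  conv-even f g zero    odd = refl
  conv-even f g (suc n) odd = +-congˡ (begin
    f 1 * g (suc (double n)) + conv (λ i → f (suc (suc i))) g (double n)
      ≈⟨ +-cong (trans (*-congˡ (odd n)) (zeroʳ _)) (conv-even (λ i → f (suc (suc i))) g n odd) ⟩
    0# + _ ≈⟨ +-identityˡ _ ⟩
    _ ∎)

  -- The triangle of index pairs splits into its row i = 0 and a triangle one smaller for the
  -- shifted `f`.
  S-conv : ∀ f g n → S (conv f g) (suc n) ≈ f 0 * S g (suc n) + S (conv (f ∘ suc) g) n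
  S-conv f g n = begin
    f 0 * g 0 + S (λ k → f 0 * g (suc k) + conv (f ∘ suc) g k) n
      ≈⟨ +-congˡ (S-+ (λ k → f 0 * g (suc k)) (conv (f ∘ suc) g) n) ⟩
    f 0 * g 0 + (S (λ k → f 0 * g (suc k)) n + S (conv (f ∘ suc) g) n)
      ≈⟨ +-assoc _ _ _ ⟨
    f 0 * g 0 + S (λ k → f 0 * g (suc k)) n + S (conv (f ∘ suc) g) n
      ≈⟨ +-congʳ (trans (+-congˡ (S-* (f 0) (g ∘ suc) n)) (sym (distribˡ _ _ _))) ⟩
    _ ∎

  1/_! : ℕ → Carrier
  1/ n ! = fromℚ (ℚ._/_ 1ℤ (n !) {{n ℕ.!≢0}})

  n!*1/n! : ∀ n → fromℕ (n !) * 1/ n ! ≈ 1#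
  n!*1/n! n = n*1/n≈1 (n !) {{n ℕ.!≢0}}

  1/n!-suc : ∀ n → fromℕ (suc n) * 1/ suc n ! ≈ 1/ n !
  1/n!-suc n = *-cancelˡ (fromℕ≉0 (n !) {{n ℕ.!≢0}}) (begin
    fromℕ (n !) * (fromℕ (suc n) * 1/ suc n !)
      ≈⟨ solve 3 (λ x y z → x :* (y :* z) := y :* x :* z) refl _ _ _ ⟩
    fromℕ (suc n) * fromℕ (n !) * 1/ suc n !
      ≈⟨ *-congʳ (fromℕ-* (suc n) (n !)) ⟨
    fromℕ (suc n !) * 1/ suc n !
      ≈⟨ n!*1/n! (suc n) ⟩
    1#
      ≈⟨ n!*1/n! n ⟨
    fromℕ (n !) * 1/ n ! ∎)

  -- The term xⁿ/n! of the exponential series; up to sign, the cosine terms are those of even index.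
  e : Carrier → ℕ → Carrier
  e x n = 1/ n ! * x ^ n

  e-suc : ∀ x n → fromℕ (suc n) * e x (suc n) ≈ x * e x n
  e-suc x n = trans
    (solve 4 (λ a w x y → a :* (w :* (x :* y)) := x :* (a :* w :* y)) refl _ _ x _)
    (*-congˡ (*-congʳ (1/n!-suc n)))

  -- The binomial theorem without binomial coefficients: both sides satisfy (n + 1) uₙ₊₁ = (x + y)
  -- uₙ, the left one by the Leibniz rule for `conv`, and n + 1 can be cancelled.
  e-+ : ∀ x y n → conv (e x) (e y) n ≈ e (x + y) n
  e-+ x y zero    = trans (*-congʳ (trans (*-identityʳ _) fromℕ-1)) (*-identityˡ _)
  e-+ x y (suc n) = *-cancelˡ (fromℕ≉0 (suc n)) (begin
    fromℕ (suc n) * conv (e x) (e y) (suc n)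
      ≈⟨ conv-leibniz 0 (e x) (e y) (suc n) ⟨
    conv (λ i → fromℕ i * e x i) (e y) (suc n) + conv (e x) (λ j → fromℕ j * e y j) (suc n)
      ≈⟨ +-cong left right ⟩
    x * conv (e x) (e y) n + y * conv (e x) (e y) n
      ≈⟨ distribʳ _ _ _ ⟨
    (x + y) * conv (e x) (e y) n
      ≈⟨ *-congˡ (e-+ x y n) ⟩
    (x + y) * e (x + y) n
      ≈⟨ e-suc (x + y) n ⟨
    fromℕ (suc n) * e (x + y) (suc n) ∎)
    where
    left : conv (λ i → fromℕ i * e x i) (e y) (suc n) ≈ x * conv (e x) (e y) n
    left = begin
      fromℕ 0 * e x 0 * e y (suc n) + conv (λ i → fromℕ (suc i) * e x (suc i)) (e y) n
        ≈⟨ +-cong (*-congʳ (trans (*-congʳ fromℕ-0) (zeroˡ _))) (conv-cong (e-suc x) (λ _ → refl) n) ⟩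
      0# * e y (suc n) + conv (λ i → x * e x i) (e y) n
        ≈⟨ +-cong (zeroˡ _) (conv-*ˡ x (e x) (e y) n) ⟩
      0# + x * conv (e x) (e y) n
        ≈⟨ +-identityˡ _ ⟩
      x * conv (e x) (e y) n ∎
    right : conv (e x) (λ j → fromℕ j * e y j) (suc n) ≈ y * conv (e x) (e y) n
    right = begin
      conv (e x) (λ j → fromℕ j * e y j) (suc n)
        ≈⟨ conv-sucʳ (e x) (λ j → fromℕ j * e y j) n ⟩
      conv (e x) (λ j → fromℕ (suc j) * e y (suc j)) n + e x (suc n) * (fromℕ 0 * e y 0)
        ≈⟨ +-cong (conv-cong (λ _ → refl) (e-suc y) n) (*-congˡ (trans (*-congʳ fromℕ-0) (zeroˡ _))) ⟩
      conv (e x) (λ j → y * e y j) n + e x (suc n) * 0#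
        ≈⟨ +-cong (conv-*ʳ y (e x) (e y) n) (zeroʳ _) ⟩
      y * conv (e x) (e y) n + 0#
        ≈⟨ +-identityʳ _ ⟩
      y * conv (e x) (e y) n ∎

  -x^double : ∀ x n → (- x) ^ double n ≈ x ^ double n
  -x^double x zero    = refl
  -x^double x (suc n) = trans (*-congˡ (*-congˡ (-x^double x n)))
    (solve 2 (λ x y → :- x :* (:- x :* y) := x :* (x :* y)) refl x _)

  e-neg-odd : ∀ x n → e x (suc (double n)) + e (- x) (suc (double n)) ≈ 0#
  e-neg-odd x n = trans (+-congˡ (*-congˡ (*-congˡ (-x^double x n))))
    (solve 3 (λ w x y → w :* (x :* y) :+ w :* (:- x :* y) := con 0ℤ) refl _ x _)

  -- Termwise, 2 cosh x cosh y = cosh (x + y) + cosh (x - y). The doubled second factor is the even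
  -- part of `e y + e (- y)`, whose odd terms vanish, so the sum over even indices is a full
  -- convolution and `e-+` applies.
  e-double : ∀ x y n → let f = λ z k → e z (double k) in
    conv (f x) (f y) n + conv (f x) (f y) n ≈ f (x + y) n + f (x - y) n
  e-double x y n = begin
    conv (f x) (f y) n + conv (f x) (f y) n
      ≈⟨ +-congˡ (conv-cong (λ _ → refl) (λ j → *-congˡ (sym (-x^double y j))) n) ⟩
    conv (f x) (f y) n + conv (f x) (f (- y)) n
      ≈⟨ conv-+ʳ (f x) (f y) (f (- y)) n ⟨
    conv (f x) (λ j → f y j + f (- y) j) n
      ≈⟨ conv-even (e x) (λ j → e y j + e (- y) j) n (e-neg-odd y) ⟨
    conv (e x) (λ j → e y j + e (- y) j) (double n)
      ≈⟨ conv-+ʳ (e x) (e y) (e (- y)) (double n) ⟩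
    conv (e x) (e y) (double n) + conv (e x) (e (- y)) (double n)
      ≈⟨ +-cong (e-+ x y (double n)) (e-+ x (- y) (double n)) ⟩
    f (x + y) n + f (x - y) n ∎
    where
    f : Carrier → ℕ → Carrier
    f z k = e z (double k)

  -- The terms of the cosine series

  sgn : ℕ → Carrier
  sgn k = fromℤ (-1ℤ ℤ.^ k)

  sgn-suc : ∀ k → sgn (suc k) ≈ - sgn k
  sgn-suc k = trans (reflexive (≡.cong fromℤ (ℤ.-1*i≡-i (-1ℤ ℤ.^ k)))) (fromℤ-neg (-1ℤ ℤ.^ k))

  conv-sgn : ∀ f g n → conv (λ i → sgn i * f i) (λ j → sgn j * g j) n ≈ sgn n * conv f g n
  conv-sgn f g zero    = trans (*-cong (trans (*-congʳ fromℕ-1) (*-identityˡ _)) (trans (*-congʳ fromℕ-1) (*-identityˡ _)))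
    (sym (trans (*-congʳ fromℕ-1) (*-identityˡ _)))
  conv-sgn f g (suc n) = begin
    sgn 0 * f 0 * (sgn (suc n) * g (suc n)) + conv (λ i → sgn (suc i) * f (suc i)) (λ j → sgn j * g j) n
      ≈⟨ +-cong (*-congʳ (trans (*-congʳ fromℕ-1) (*-identityˡ _)))
           (conv-cong (λ i → trans (*-congʳ (sgn-suc i))
              (solve 2 (λ s x → :- s :* x := :- con 1ℤ :* (s :* x)) refl _ _)) (λ _ → refl) n) ⟩
    f 0 * (sgn (suc n) * g (suc n)) + conv (λ i → - 1# * (sgn i * f (suc i))) (λ j → sgn j * g j) n
      ≈⟨ +-congˡ (trans (conv-*ˡ (- 1#) (λ i → sgn i * f (suc i)) (λ j → sgn j * g j) n) (*-congˡ (conv-sgn (f ∘ suc) g n))) ⟩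
    f 0 * (sgn (suc n) * g (suc n)) + - 1# * (sgn n * conv (f ∘ suc) g n)
      ≈⟨ +-congˡ (trans (solve 2 (λ s x → :- con 1ℤ :* (s :* x) := :- s :* x) refl _ _) (*-congʳ (sym (sgn-suc n)))) ⟩
    f 0 * (sgn (suc n) * g (suc n)) + sgn (suc n) * conv (f ∘ suc) g n
      ≈⟨ solve 4 (λ s x y z → x :* (s :* y) :+ s :* z := s :* (x :* y :+ z)) refl _ _ _ _ ⟩
    sgn (suc n) * conv f g (suc n) ∎

  -- Verbatim the summand of `cosPartialSum`, so that the partial sum is definitionally
  -- `S (cosTerm x)`.
  cosTerm : Carrier → ℕ → Carrier
  cosTerm x k = fromℚ (ℚ._/_ (-1ℤ ℤ.^ k) ((2 ℕ.* k) !) {{(2 ℕ.* k) ℕ.!≢0}}) * x ^ (2 ℕ.* k)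

  cosTerm-cong : ∀ {x y} → x ≈ y → ∀ k → cosTerm x k ≈ cosTerm y k
  cosTerm-cong x≈y k = *-congˡ (^-congˡ (2 ℕ.* k) x≈y)

  cosTerm≈ : ∀ x k → cosTerm x k ≈ sgn k * e x (double k)
  cosTerm≈ x k = trans (*-congʳ (fromℚ-/ (-1ℤ ℤ.^ k) ((2 ℕ.* k) !) {{(2 ℕ.* k) ℕ.!≢0}}))
    (trans (*-assoc _ _ _) (*-congˡ (reflexive (≡.cong (e x) (2*n≡double k)))))

  cosTerm-product : ∀ x y n →
    conv (cosTerm x) (cosTerm y) n + conv (cosTerm x) (cosTerm y) n ≈ cosTerm (x + y) n + cosTerm (x - y) n
  cosTerm-product x y n = begin
    conv (cosTerm x) (cosTerm y) n + conv (cosTerm x) (cosTerm y) n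
      ≈⟨ +-cong signs signs ⟩
    sgn n * conv (λ i → e x (double i)) (λ j → e y (double j)) n
      + sgn n * conv (λ i → e x (double i)) (λ j → e y (double j)) n
      ≈⟨ distribˡ _ _ _ ⟨
    _ ≈⟨ *-congˡ (e-double x y n) ⟩
    _ ≈⟨ distribˡ _ _ _ ⟩
    sgn n * e (x + y) (double n) + sgn n * e (x - y) (double n)
      ≈⟨ +-cong (cosTerm≈ (x + y) n) (cosTerm≈ (x - y) n) ⟨
    cosTerm (x + y) n + cosTerm (x - y) n ∎
    where
    signs : conv (cosTerm x) (cosTerm y) n ≈ sgn n * conv (λ i → e x (double i)) (λ j → e y (double j)) n
    signs = trans (conv-cong (cosTerm≈ x) (cosTerm≈ y) n)
                  (conv-sgn (λ i → e x (double i)) (λ j → e y (double j)) n)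

  -- Geometric estimates

  η : Carrier
  η = fromℚ (1ℤ ℚ./ 8)

  nonNeg-η^ : ∀ k → NonNeg (η ^ k)
  nonNeg-η^ zero    = pos⇒nonNeg 0<1
  nonNeg-η^ (suc k) = nonNeg-* (pos⇒nonNeg (1/n-pos 8)) (nonNeg-η^ k)

  8^*η^ : ∀ k → fromℕ (8 ℕ.^ k) * η ^ k ≈ 1#
  8^*η^ zero    = trans (*-identityʳ _) fromℕ-1
  8^*η^ (suc k) = begin
    fromℕ (8 ℕ.* 8 ℕ.^ k) * (η * η ^ k)
      ≈⟨ *-congʳ (fromℕ-* 8 (8 ℕ.^ k)) ⟩
    fromℕ 8 * fromℕ (8 ℕ.^ k) * (η * η ^ k)
      ≈⟨ solve 4 (λ a b c d → a :* b :* (c :* d) := a :* c :* (b :* d)) refl _ _ _ _ ⟩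
    fromℕ 8 * η * (fromℕ (8 ℕ.^ k) * η ^ k)
      ≈⟨ *-cong (n*1/n≈1 8) (8^*η^ k) ⟩
    1# * 1# ≈⟨ *-identityˡ 1# ⟩
    1# ∎

  η^≤1 : ∀ k → NonNeg (1# - η ^ k)
  η^≤1 k = nonNeg-resp eq (nonNeg-* (fromℕ-mono (ℕ.m^n>0 8 k)) (nonNeg-η^ k))
    where
    eq : (fromℕ (8 ℕ.^ k) - fromℕ 1) * η ^ k ≈ 1# - η ^ k
    eq = trans (solve 3 (λ a b x → (a :- b) :* x := a :* x :- b :* x) refl _ _ _)
      (+-cong (8^*η^ k) (-‿cong (trans (*-congʳ fromℕ-1) (*-identityˡ _))))

  -- Each of the `i` terms is bounded by the bound of the first one. This is crude, but it avoids
  -- summing the geometric series, and the factor `i` is affordable.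
  S-tail : ∀ {g K} → NonNeg K → (∀ j → g j ≼ K * η ^ j) →
           ∀ i n → S g (i ℕ.+ n) - S g n ≼ fromℕ i * (K * η ^ n)
  S-tail {g} {K} K≥0 g≼ zero    n = ≼-resp (sym (-‿inverseʳ _)) (sym (trans (*-congʳ fromℕ-0) (zeroˡ _))) (0≼ nonNeg-0)
  S-tail {g} {K} K≥0 g≼ (suc i) n = ≼-resp
    (trans (solve 3 (λ s t u → s :- t :+ u := s :+ u :- t) refl _ _ _) (+-congʳ (sym (S-last g (i ℕ.+ n)))))
    (trans (solve 2 (λ i b → i :* b :+ b := (con 1ℤ :+ i) :* b) refl _ _) (*-congʳ (sym (fromℕ-suc i))))
    (≼-+ (S-tail K≥0 g≼ i n) (≼-weaken (g≼ (i ℕ.+ n)) (nonNeg-resp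
      (trans (solve 3 (λ K a b → K :* ((con 1ℤ :- a) :* b) := K :* b :- K :* (a :* b)) refl K _ _)
        (+-congˡ (-‿cong (*-congˡ (sym (^-homo-* η i n))))))
      (nonNeg-* K≥0 (nonNeg-* (η^≤1 i) (nonNeg-η^ n))))))

  -- The square of index pairs minus the triangle, row by row. The parameter `i` counts the rows
  -- already removed: the next row leaves a tail of `i` terms of `g`, bounded by
  -- `i * L * η ^ (N - i)`, times an entry of `f` bounded by `K * η ^ i`. Every row thus has the
  -- same power `η ^ N`.
  cauchyProduct-error : ∀ {f g K L} → NonNeg K → NonNeg L → (i n N : ℕ) → i ℕ.+ n ≡ N →
    (∀ j → f j ≼ K * η ^ (i ℕ.+ j)) → (∀ j → g j ≼ L * η ^ j) →
    S f n * S g N - S (conv f g) n ≼ fromℕ n * (fromℕ N * (K * L * η ^ N))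
  cauchyProduct-error {f} {g} {K} {L} K≥0 L≥0 i zero N i+n≡N f≼ g≼ =
    ≼-resp (solve 1 (λ x → con 0ℤ := con 0ℤ :* x :- con 0ℤ) refl _) (sym (trans (*-congʳ fromℕ-0) (zeroˡ _))) (0≼ nonNeg-0)
  cauchyProduct-error {f} {g} {K} {L} K≥0 L≥0 i (suc n) N ≡.refl f≼ g≼ = ≼-resp
    (begin
      f 0 * (S g N - S g (suc n)) + (S (f ∘ suc) n * S g N - S (conv (f ∘ suc) g) n)
        ≈⟨ solve 5 (λ a s t u v → a :* (s :- t) :+ (u :* s :- v) := (a :+ u) :* s :- (a :* t :+ v)) refl _ _ _ _ _ ⟩
      S f (suc n) * S g N - (f 0 * S g (suc n) + S (conv (f ∘ suc) g) n)
        ≈⟨ +-congˡ (-‿cong (S-conv f g n)) ⟨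
      S f (suc n) * S g N - S (conv f g) (suc n) ∎)
    (trans (solve 2 (λ n b → b :+ n :* b := (con 1ℤ :+ n) :* b) refl _ _) (*-congʳ (sym (fromℕ-suc n))))
    (≼-+ head
      (cauchyProduct-error K≥0 L≥0 (suc i) n N (≡.sym (ℕ.+-suc i n))
        (λ j → ≡.subst (λ k → f (suc j) ≼ K * η ^ k) (ℕ.+-suc i j) (f≼ (suc j))) g≼))
    where
    head : f 0 * (S g N - S g (suc n)) ≼ fromℕ N * (K * L * η ^ N)
    head = ≼-weaken
      (≼-resp refl (begin
          K * η ^ (i ℕ.+ 0) * (fromℕ i * (L * η ^ suc n))
            ≈⟨ *-congʳ (*-congˡ (^-congʳ η (ℕ.+-identityʳ i))) ⟩
          K * η ^ i * (fromℕ i * (L * η ^ suc n))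
            ≈⟨ solve 5 (λ K a i L b → K :* a :* (i :* (L :* b)) := i :* (K :* L :* (a :* b))) refl _ _ _ _ _ ⟩
          fromℕ i * (K * L * (η ^ i * η ^ suc n))
            ≈⟨ *-congˡ (*-congˡ (^-homo-* η i (suc n))) ⟨
          fromℕ i * (K * L * η ^ N) ∎)
        (≼-* (f≼ 0) (S-tail L≥0 g≼ i (suc n))))
      (nonNeg-resp (solve 3 (λ N i b → (N :- i) :* b := N :* b :- i :* b) refl _ _ _)
        (nonNeg-* (fromℕ-mono (ℕ.m≤m+n i (suc n))) (nonNeg-* (nonNeg-* K≥0 L≥0) (nonNeg-η^ N))))

  sgn-≼ : ∀ k → sgn k ≼ 1#
  sgn-≼ zero    = ≼-resp (sym fromℕ-1) refl (nonNeg⇒≼ (pos⇒nonNeg 0<1))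
  sgn-≼ (suc k) = ≼-resp (sym (sgn-suc k)) refl (≼-neg (sgn-≼ k))

  -- With a natural bound `b` for `x` this becomes an inequality of natural numbers, multiplied by
  -- `η ^ k` and divided by the factorial of 2k.
  cosTerm-≼ : ∀ x → ∃ λ K → ∀ k → cosTerm x k ≼ fromℕ K * η ^ k
  cosTerm-≼ x = K , λ k → ≼-weaken
      (≼-resp (sym (cosTerm≈ x k)) (*-identityˡ _)
        (≼-* (sgn-≼ k) (≼-* (nonNeg⇒≼ (w≥0 (double k))) (≼-^ (double k) (proj₂ (bounded x))))))
      (nonNeg-resp (eq k) (nonNeg-* (nonNeg-* (w≥0 (double k)) (nonNeg-η^ k)) (fromℕ-mono (proj₂ (8^k*b^double≤K*double! b) k))))
    where
    b = proj₁ (bounded x)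
    K = proj₁ (8^k*b^double≤K*double! b)
    w≥0 : ∀ n → NonNeg (1/ n !)
    w≥0 n = pos⇒nonNeg (1/n-pos (n !) {{n ℕ.!≢0}})
    eq : ∀ k → 1/ double k ! * η ^ k * (fromℕ (K ℕ.* double k !) - fromℕ (8 ℕ.^ k ℕ.* b ℕ.^ double k))
             ≈ fromℕ K * η ^ k - 1/ double k ! * fromℕ b ^ double k
    eq k = begin
      w * h * (fromℕ (K ℕ.* double k !) - fromℕ (8 ℕ.^ k ℕ.* b ℕ.^ double k))
        ≈⟨ *-congˡ (+-cong (fromℕ-* K (double k !))
             (-‿cong (trans (fromℕ-* (8 ℕ.^ k) (b ℕ.^ double k)) (*-congˡ (fromℕ-^ b (double k)))))) ⟩
      w * h * (A * F - P * B)
        ≈⟨ solve 6 (λ w h A F P B → w :* h :* (A :* F :- P :* B) := A :* h :* (F :* w) :- w :* B :* (P :* h))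
             refl w h A F P B ⟩
      A * h * (F * w) - w * B * (P * h)
        ≈⟨ +-cong (trans (*-congˡ (n!*1/n! (double k))) (*-identityʳ _))
             (-‿cong (trans (*-congˡ (8^*η^ k)) (*-identityʳ _))) ⟩
      A * h - w * B ∎
      where
      w = 1/ double k !
      h = η ^ k
      A = fromℕ K
      F = fromℕ (double k !)
      P = fromℕ (8 ℕ.^ k)
      B = fromℕ b ^ double k

  -- Passage to the limit in the product formula

  module _ (cos : Carrier → Carrier) (isCosine : IsCosine ℝ cos) where

    -- As n + 1 ≤ N, the polynomial factor is at most N³ ≤ 8 ^ N, which cancels `η ^ N`.
    product-error : ∀ n N {K} → suc n ℕ.≤ N → NonNeg K → ∀ {x} → x ≼ fromℕ N * (fromℕ N * (K * η ^ N)) →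
                    fromℕ (suc n) * x ≼ K
    product-error n N {K} 1+n≤N K≥0 {x} x≼ = ≼-weaken (≼-* (nonNeg⇒≼ (nonNeg-fromℕ (suc n))) x≼)
      (nonNeg-resp eq (nonNeg-* (nonNeg-* K≥0 (nonNeg-η^ N)) (fromℕ-mono bound)))
      where
      bound : suc n ℕ.* (N ℕ.* N) ℕ.≤ 8 ℕ.^ N
      bound = ℕ.≤-trans (ℕ.*-monoˡ-≤ (N ℕ.* N) 1+n≤N) (n³≤8^n N)
      eq : K * η ^ N * (fromℕ (8 ℕ.^ N) - fromℕ (suc n ℕ.* (N ℕ.* N)))
         ≈ K - fromℕ (suc n) * (fromℕ N * (fromℕ N * (K * η ^ N)))
      eq = begin
        K * η ^ N * (fromℕ (8 ℕ.^ N) - fromℕ (suc n ℕ.* (N ℕ.* N)))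
          ≈⟨ *-congˡ (+-congˡ (-‿cong (trans (fromℕ-* (suc n) (N ℕ.* N)) (*-congˡ (fromℕ-* N N))))) ⟩
        K * η ^ N * (fromℕ (8 ℕ.^ N) - fromℕ (suc n) * (fromℕ N * fromℕ N))
          ≈⟨ solve 5 (λ K h P s N → K :* h :* (P :- s :* (N :* N)) := K :* (P :* h) :- s :* (N :* (N :* (K :* h)))) refl _ _ _ _ _ ⟩
        K * (fromℕ (8 ℕ.^ N) * η ^ N) - fromℕ (suc n) * (fromℕ N * (fromℕ N * (K * η ^ N)))
          ≈⟨ +-congʳ (trans (*-congˡ (8^*η^ N)) (*-identityʳ K)) ⟩
        _ ∎

    private
      Eventually : (ℕ → Set ℓ₂) → Set ℓ₂
      Eventually P = ∃ λ N → ∀ k → N ℕ.≤ k → P k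

      eventually-× : ∀ {P Q : ℕ → Set ℓ₂} → Eventually P → Eventually Q → Eventually λ k → P k × Q k
      eventually-× (M , p) (N , q) =
        M ℕ.+ N , λ k M+N≤k → p k (ℕ.m+n≤o⇒m≤o M M+N≤k) , q k (ℕ.m+n≤o⇒n≤o M M+N≤k)

      C : Carrier → ℕ → Carrier
      C = cosPartialSum ℝ

      convergence₁ : ∀ x → Eventually λ N → C x N - cos x ≼ 1#
      convergence₁ x = proj₁ l , λ k N≤k → within⇒≼ (proj₂ l k N≤k)
        where l = isCosine x 1# 0<1

      convergence : ∀ n x → Eventually λ N → fromℕ (suc n) * (C x N - cos x) ≼ 1#
      convergence n x = proj₁ l , λ k N≤k → ≼-resp refl (n*1/n≈1 (suc n))
        (≼-* (nonNeg⇒≼ (nonNeg-fromℕ (suc n))) (within⇒≼ (proj₂ l k N≤k)))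
        where l = isCosine x _ (1/n-pos (suc n))

      -- With Q the Cauchy product of Cx and Cy truncated to total degree < N
      estimate : ∀ {ν Cu Cv Cx Cy Q u v x y E A B} → Q + Q ≈ Cu + Cv →
        ν * (Cx * Cy - Q) ≼ E → x ≼ A → y ≼ B →
        (ν * (Cu - u) ≼ 1# × ν * (Cv - v) ≼ 1#) × (ν * (Cx - x) ≼ 1# × ν * (Cy - y) ≼ 1#) × Cy - y ≼ 1# →
        ν * (u + v - 2# * (x * y))
          ≼ 1# + 1# + (E + E) + ((1# * 1# + 1# * B + A * 1#) + (1# * 1# + 1# * B + A * 1#))
      estimate {ν} {Cu} {Cv} {Cx} {Cy} {Q} {u} {v} {x} {y} {E} {A} {B} 2Q err x≼A y≼B ((u≼ , v≼) , (x≼ , y≼) , y≼1) =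
        ≼-resp eq refl (≼-+ (≼-+ (≼-+ (≼-neg u≼) (≼-neg v≼)) (≼-+ (≼-neg err) (≼-neg err))) (≼-+ cross cross))
        where
        -- This is `ν * (Cx * Cy - x * y)`. Each summand carries ν on one error factor only, so for
        -- the other error factor the unscaled bound 1 is enough.
        cross : ν * (Cx - x) * (Cy - y) + ν * (Cx - x) * y + x * (ν * (Cy - y)) ≼ 1# * 1# + 1# * B + A * 1#
        cross = ≼-+ (≼-+ (≼-* x≼ y≼1) (≼-* x≼ y≼B)) (≼-* x≼A y≼)
        eq : - (ν * (Cu - u)) + - (ν * (Cv - v)) + (- (ν * (Cx * Cy - Q)) + - (ν * (Cx * Cy - Q)))
               + ((ν * (Cx - x) * (Cy - y) + ν * (Cx - x) * y + x * (ν * (Cy - y)))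
               + (ν * (Cx - x) * (Cy - y) + ν * (Cx - x) * y + x * (ν * (Cy - y))))
             ≈ ν * (u + v - 2# * (x * y))
        eq = begin
          _ ≈⟨ +-cong
                 (solve 8 (λ ν u v Cu Cv Cx Cy Q →
                   :- (ν :* (Cu :- u)) :+ :- (ν :* (Cv :- v)) :+ (:- (ν :* (Cx :* Cy :- Q)) :+ :- (ν :* (Cx :* Cy :- Q)))
                   := ν :* (u :+ v :- (Cx :* Cy :+ Cx :* Cy) :+ (Q :+ Q :- (Cu :+ Cv))))
                   refl ν u v Cu Cv Cx Cy Q)
                 (solve 5 (λ ν x y Cx Cy →
                   (ν :* (Cx :- x) :* (Cy :- y) :+ ν :* (Cx :- x) :* y :+ x :* (ν :* (Cy :- y)))
                   :+ (ν :* (Cx :- x) :* (Cy :- y) :+ ν :* (Cx :- x) :* y :+ x :* (ν :* (Cy :- y)))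
                   := ν :* (Cx :* Cy :+ Cx :* Cy :- (con 1ℤ :+ con 1ℤ) :* (x :* y)))
                   refl ν x y Cx Cy) ⟩
          ν * (u + v - (Cx * Cy + Cx * Cy) + (Q + Q - (Cu + Cv))) + ν * (Cx * Cy + Cx * Cy - 2# * (x * y))
            ≈⟨ +-congʳ (*-congˡ (trans (+-congˡ (trans (+-congʳ 2Q) (-‿inverseʳ _))) (+-identityʳ _))) ⟩
          ν * (u + v - (Cx * Cy + Cx * Cy)) + ν * (Cx * Cy + Cx * Cy - 2# * (x * y))
            ≈⟨ solve 4 (λ ν w z t → ν :* (w :- z) :+ ν :* (z :- t) := ν :* (w :- t)) refl ν (u + v) (Cx * Cy + Cx * Cy) (2# * (x * y)) ⟩
          ν * (u + v - 2# * (x * y)) ∎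

    -- The arguments `u` and `v` are given only up to `≈`, because `cos` is not yet known to respect
    -- it; this freedom is what `cos-cong` exploits.
    cosine-product : ∀ {x y u v} → u ≈ x + y → v ≈ x - y → cos u + cos v ≈ 2# * (cos x * cos y)
    cosine-product {x} {y} {u} {v} u≈x+y v≈x-y = x∙y⁻¹≈ε⇒x≈y _ _ (infinitesimal _ λ n → bound n (close n))
      where
      K = cosTerm-≼ x
      L = cosTerm-≼ y
      Close : ℕ → ℕ → Set ℓ₂
      Close n N = (fromℕ (suc n) * (C u N - cos u) ≼ 1# × fromℕ (suc n) * (C v N - cos v) ≼ 1#) ×
                  (fromℕ (suc n) * (C x N - cos x) ≼ 1# × fromℕ (suc n) * (C y N - cos y) ≼ 1#) × C y N - cos y ≼ 1#
      close : ∀ n → Eventually (Close n)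
      close n = eventually-× (eventually-× (convergence n u) (convergence n v))
        (eventually-× (eventually-× (convergence n x) (convergence n y)) (convergence₁ y))
      terms : ∀ k → conv (cosTerm x) (cosTerm y) k + conv (cosTerm x) (cosTerm y) k ≈ cosTerm u k + cosTerm v k
      terms k = trans (cosTerm-product x y k)
        (sym (+-cong (cosTerm-cong u≈x+y k) (cosTerm-cong v≈x-y k)))
      bound : ∀ n → Eventually (Close n) → _
      bound n (M , close) = estimate
        (trans (sym (S-+ (conv (cosTerm x) (cosTerm y)) (conv (cosTerm x) (cosTerm y)) N))
          (trans (S-cong terms N) (S-+ (cosTerm u) (cosTerm v) N)))
        (product-error n N (ℕ.m≤m+n (suc n) M) (nonNeg-* (nonNeg-fromℕ (proj₁ K)) (nonNeg-fromℕ (proj₁ L)))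
          (cauchyProduct-error (nonNeg-fromℕ (proj₁ K)) (nonNeg-fromℕ (proj₁ L)) 0 N N ≡.refl (proj₂ K) (proj₂ L)))
        (proj₂ (bounded (cos x))) (proj₂ (bounded (cos y)))
        (close N (ℕ.m≤n+m M (suc n)))
        -- `N` has to exceed `n` for `product-error` and reach `M` for convergence.
        where N = suc n ℕ.+ M

    -- Both cos x + cos y and cos y + cos y are instances of the product formula with right-hand
    -- side 2 cos y cos 0.
    cos-cong : ∀ {x y} → x ≈ y → cos x ≈ cos y
    cos-cong {x} {y} x≈y = begin
      cos x                   ≈⟨ solve 2 (λ a b → a := a :+ b :- b) refl _ _ ⟩
      cos x + cos y - cos y   ≈⟨ +-congʳ (cosine-product (trans x≈y y≈y+0) y≈y-0) ⟩
      _                       ≈⟨ +-congʳ (cosine-product y≈y+0 y≈y-0) ⟨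
      cos y + cos y - cos y   ≈⟨ solve 2 (λ a b → a :+ b :- b := a) refl _ _ ⟩
      cos y                   ∎
      where
      y≈y+0 : y ≈ y + 0#
      y≈y+0 = sym (+-identityʳ y)
      y≈y-0 : y ≈ y - 0#
      y≈y-0 = solve 1 (λ y → y := y :- con 0ℤ) refl y

-- The cosine on an equally spaced grid

module CosineGrid {c ℓ₁ ℓ₂} (ℝ : RealField c ℓ₁ ℓ₂) where
  open RealProperties ℝ
  open CosineProduct ℝ using (S; S-cong; S-+; S-*; S-last)
  open SetoidReasoning setoid

  -- D m stands for cos (π m / 4 n), so that D (2 n) = cos (π / 2).
  module Grid (n : ℕ) .{{_ : NonZero n}} (D : ℤ → Carrier)
    (D-product : ∀ a b → D (a ℤ.+ b) + D (a ℤ.- b) ≈ 2# * (D a * D b))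
    (D-2n≈0 : D (+ (2 ℕ.* n)) ≈ 0#)
    (D≉0 : ∀ m → 0 ℕ.< m → m ℕ.< 2 ℕ.* n → ¬ D (+ m) ≈ 0#)
    where

    private
      D-≡ : ∀ {a b} → a ≡ b → D a ≈ D b
      D-≡ a≡b = reflexive (≡.cong D a≡b)

      2x≈2y⇒x≈y : ∀ {x y} → x + x ≈ 2# * y → x ≈ y
      2x≈2y⇒x≈y {x} {y} eq = *-cancelˡ 2≉0 (trans (solve 1 (λ x → (con 1ℤ :+ con 1ℤ) :* x := x :+ x) refl x) eq)

    -- The product formula at (1, 0) gives `D 1 ≈ D 1 * D 0`, and `D 1` can be cancelled since 1 <
    -- 2n.
    D-0 : D 0ℤ ≈ 1#
    D-0 = *-cancelˡ (D≉0 1 ℕ.z<s (ℕ.*-mono-≤ {2} {2} {1} ℕ.≤-refl (ℕ.>-nonZero⁻¹ n)))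
      (trans (sym (2x≈2y⇒x≈y (D-product 1ℤ 0ℤ))) (sym (*-identityʳ _)))

    D-even : ∀ a → D (ℤ.- a) ≈ D a
    D-even a = begin
      D (ℤ.- a)                        ≈⟨ solve 2 (λ x y → x := y :+ x :- y) refl _ _ ⟩
      D a + D (ℤ.- a) - D a            ≈⟨ +-congʳ (+-cong (D-≡ (ℤ.+-identityˡ a)) (D-≡ (ℤ.+-identityˡ (ℤ.- a)))) ⟨
      D (0ℤ ℤ.+ a) + D (0ℤ ℤ.- a) - D a ≈⟨ +-congʳ (D-product 0ℤ a) ⟩
      2# * (D 0ℤ * D a) - D a          ≈⟨ +-congʳ (*-congˡ (*-congʳ D-0)) ⟩
      2# * (1# * D a) - D a            ≈⟨ solve 1 (λ x → (con 1ℤ :+ con 1ℤ) :* (con 1ℤ :* x) :- x := x) refl _ ⟩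
      D a                              ∎

    D-double : ∀ a → D (a ℤ.+ a) ≈ 2# * (D a * D a) - 1#
    D-double a = begin
      D (a ℤ.+ a)                          ≈⟨ solve 2 (λ x y → x := x :+ y :- y) refl _ _ ⟩
      D (a ℤ.+ a) + D (a ℤ.- a) - D (a ℤ.- a) ≈⟨ +-cong (D-product a a) (-‿cong (trans (D-≡ (ℤ.+-inverseʳ a)) D-0)) ⟩
      2# * (D a * D a) - 1#                ∎

    private
      q : ℤ
      q = + (2 ℕ.* n)

    -- That cos (a + π) = - cos a, without the sine: in the product formula at a + π/2 and π/2 the
    -- right-hand side vanishes.
    D-antiperiod : ∀ a → D (a ℤ.+ (q ℤ.+ q)) ≈ - D a
    D-antiperiod a = begin
      D (a ℤ.+ (q ℤ.+ q))
        ≈⟨ solve 2 (λ x y → x := x :+ y :- y) refl _ _ ⟩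
      D (a ℤ.+ (q ℤ.+ q)) + D a - D a
        ≈⟨ +-congʳ (+-cong (D-≡ (≡.sym (ℤ.+-assoc a q q))) (D-≡ (cancel a q))) ⟩
      D (a ℤ.+ q ℤ.+ q) + D (a ℤ.+ q ℤ.- q) - D a
        ≈⟨ +-congʳ (D-product (a ℤ.+ q) q) ⟩
      2# * (D (a ℤ.+ q) * D q) - D a
        ≈⟨ +-congʳ (*-congˡ (*-congˡ D-2n≈0)) ⟩
      2# * (D (a ℤ.+ q) * 0#) - D a
        ≈⟨ solve 2 (λ x y → (con 1ℤ :+ con 1ℤ) :* (x :* con 0ℤ) :- y := :- y) refl _ _ ⟩
      - D a ∎
      where
      cancel : ∀ a b → a ≡ a ℤ.+ b ℤ.- b
      cancel = solve-∀

    D-period : ∀ a → D (a ℤ.+ + 8 ℤ.* + n) ≈ D a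
    D-period a = begin
      D (a ℤ.+ + 8 ℤ.* + n)                       ≈⟨ D-≡ (≡.trans (eq a (+ n)) (≡.cong (λ p → a ℤ.+ (p ℤ.+ p) ℤ.+ (p ℤ.+ p)) (≡.sym (ℤ.pos-* 2 n)))) ⟩
      D (a ℤ.+ (q ℤ.+ q) ℤ.+ (q ℤ.+ q))           ≈⟨ D-antiperiod (a ℤ.+ (q ℤ.+ q)) ⟩
      - D (a ℤ.+ (q ℤ.+ q))                       ≈⟨ -‿cong (D-antiperiod a) ⟩
      - - D a                                     ≈⟨ -‿involutive (D a) ⟩
      D a                                         ∎
      where
      eq : ∀ a n → a ℤ.+ + 8 ℤ.* n ≡ a ℤ.+ (+ 2 ℤ.* n ℤ.+ + 2 ℤ.* n) ℤ.+ (+ 2 ℤ.* n ℤ.+ + 2 ℤ.* n)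
      eq = solve-∀

    -- If cos ψ = 1 then cos (x + ψ) cos (x - ψ) = cos² x; take x + ψ = π / 2.
    D≉1 : ∀ m → 0 ℕ.< m → m ℕ.< 2 ℕ.* n → ¬ D (+ m) ≈ 1#
    D≉1 m 0<m m<2n Dm≈1 = D≉0 (2 ℕ.* n ℕ.∸ m) (ℕ.m<n⇒0<n∸m m<2n) (ℕ.∸-monoʳ-< 0<m (ℕ.<⇒≤ m<2n))
      (x²≈0⇒x≈0 (begin
        D k * D k
          ≈⟨ c²≈product ⟩
        D (k ℤ.+ + m) * D (k ℤ.- + m)
          ≈⟨ *-congʳ (trans (D-≡ k+m≡q) D-2n≈0) ⟩
        0# * D (k ℤ.- + m)
          ≈⟨ zeroˡ _ ⟩
        0# ∎))
      where
      k : ℤ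
      k = + (2 ℕ.* n ℕ.∸ m)
      k+m≡q : k ℤ.+ + m ≡ q
      k+m≡q = ≡.cong +_ (ℕ.m∸n+n≡m (ℕ.<⇒≤ m<2n))
      x²≈0⇒x≈0 : ∀ {x} → x * x ≈ 0# → x ≈ 0#
      x²≈0⇒x≈0 {x} x²≈0 = ≈-by-cases
        (λ x<0 → <-irrefl (sym (trans (solve 1 (λ x → :- x :* :- x := x :* x) refl x) x²≈0)) (*-pos (x<0⇒0<-x x<0) (x<0⇒0<-x x<0)))
        (λ 0<x → <-irrefl (sym x²≈0) (*-pos 0<x 0<x))
      sum≡ : ∀ a b → a ℤ.+ b ℤ.+ (a ℤ.- b) ≡ a ℤ.+ a
      sum≡ = solve-∀
      difference≡ : ∀ a b → a ℤ.+ b ℤ.- (a ℤ.- b) ≡ b ℤ.+ b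
      difference≡ = solve-∀
      c²≈product : D k * D k ≈ D (k ℤ.+ + m) * D (k ℤ.- + m)
      c²≈product = 2x≈2y⇒x≈y (begin
        D k * D k + D k * D k
          ≈⟨ solve 1 (λ x → x :* x :+ x :* x := (con 1ℤ :+ con 1ℤ) :* (x :* x) :- con 1ℤ
                         :+ ((con 1ℤ :+ con 1ℤ) :* (con 1ℤ :* con 1ℤ) :- con 1ℤ)) refl (D k) ⟩
        2# * (D k * D k) - 1# + (2# * (1# * 1#) - 1#)
          ≈⟨ +-cong (D-double k) (trans (D-double (+ m)) (+-congʳ (*-congˡ (*-cong Dm≈1 Dm≈1)))) ⟨
        D (k ℤ.+ k) + D (+ m ℤ.+ + m)
          ≈⟨ +-cong (D-≡ (sum≡ k (+ m))) (D-≡ (difference≡ k (+ m))) ⟨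
        D (k ℤ.+ + m ℤ.+ (k ℤ.- + m)) + D (k ℤ.+ + m ℤ.- (k ℤ.- + m))
          ≈⟨ D-product (k ℤ.+ + m) (k ℤ.- + m) ⟩
        2# * (D (k ℤ.+ + m) * D (k ℤ.- + m)) ∎)

    -- cos 8ψ - 1 = 16 cos² ψ cos² 2ψ (cos 2ψ - 1)
    D-8≉1 : ∀ m → 0 ℕ.< m → m ℕ.< n → ¬ D (+ 8 ℤ.* + m) ≈ 1#
    D-8≉1 m 0<m m<n D8m≈1 =
      -- With ψ the angle of `m`, both ψ and 2ψ lie strictly between 0 and π/2, so their cosines are
      -- nonzero, and cos 2ψ ≠ 1 by `D≉1`. Cancelling these factors and the four factors 2 leaves
      -- cos ψ = 0.
      x≉0 (cancel2 (cancel2 (cancel2 (cancel2 (*-cancel-0 x≉0 (*-cancel-0 y≉0 (*-cancel-0 y≉0 (*-cancel-0 y-1≉0 (begin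
        (y - 1#) * (y * (y * (x * (2# * (2# * (2# * (2# * x)))))))
          ≈⟨ solve 2 (λ x y → let 2ₛ = con 1ℤ :+ con 1ℤ in
               (y :- con 1ℤ) :* (y :* (y :* (x :* (2ₛ :* (2ₛ :* (2ₛ :* (2ₛ :* x)))))))
               := con (+ 8) :* (y :- con 1ℤ) :* (y :* y) :* (2ₛ :* (x :* x) :- con 1ℤ :+ con 1ℤ)) refl x y ⟩
        _ ≈⟨ *-congˡ (+-congʳ (D-double (+ m))) ⟨
        _ ≈⟨ solve 1 (λ y → let 2ₛ = con 1ℤ :+ con 1ℤ in
               con (+ 8) :* (y :- con 1ℤ) :* (y :* y) :* (y :+ con 1ℤ)
               := 2ₛ :* ((2ₛ :* (y :* y) :- con 1ℤ) :* (2ₛ :* (y :* y) :- con 1ℤ)) :- con 1ℤ :- con 1ℤ) refl y ⟩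
        _ ≈⟨ +-congʳ (+-congʳ (*-congˡ (*-cong (D-double (+ m ℤ.+ + m)) (D-double (+ m ℤ.+ + m))))) ⟨
        _ ≈⟨ +-congʳ (D-double (+ m ℤ.+ + m ℤ.+ (+ m ℤ.+ + m))) ⟨
        _ ≈⟨ +-congʳ (D-≡ (eq (+ m))) ⟨
        D (+ 8 ℤ.* + m) - 1#
          ≈⟨ trans (+-congʳ D8m≈1) (-‿inverseʳ 1#) ⟩
        0# ∎)))))))))
      where
      x = D (+ m)
      y = D (+ m ℤ.+ + m)
      m+m<2n : m ℕ.+ m ℕ.< 2 ℕ.* n
      m+m<2n = ≡.subst (m ℕ.+ m ℕ.<_) (≡.cong (n ℕ.+_) (≡.sym (ℕ.+-identityʳ n))) (ℕ.+-mono-< m<n m<n)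
      cancel2 : ∀ {z} → 2# * z ≈ 0# → z ≈ 0#
      cancel2 = *-cancel-0 2≉0
      x≉0 = D≉0 m 0<m (ℕ.<-≤-trans m<n (ℕ.m≤m+n n _))
      y≉0 = D≉0 (m ℕ.+ m) (ℕ.<-≤-trans 0<m (ℕ.m≤m+n m m)) m+m<2n
      y-1≉0 : ¬ y - 1# ≈ 0#
      y-1≉0 y-1≈0 = D≉1 (m ℕ.+ m) (ℕ.<-≤-trans 0<m (ℕ.m≤m+n m m)) m+m<2n (x∙y⁻¹≈ε⇒x≈y _ _ y-1≈0)
      eq : ∀ a → + 8 ℤ.* a ≡ (a ℤ.+ a ℤ.+ (a ℤ.+ a)) ℤ.+ (a ℤ.+ a ℤ.+ (a ℤ.+ a))
      eq = solve-∀

    -- cos (2 π m / n)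
    G : ℤ → Carrier
    G m = D (+ 8 ℤ.* m)

    private
      G-≡ : ∀ {a b} → a ≡ b → G a ≈ G b
      G-≡ a≡b = reflexive (≡.cong G a≡b)

    G-0 : G 0ℤ ≈ 1#
    G-0 = D-0

    G-product : ∀ a b → G (a ℤ.+ b) + G (a ℤ.- b) ≈ 2# * (G a * G b)
    G-product a b = trans (+-cong (D-≡ (eq₁ a b)) (D-≡ (eq₂ a b))) (D-product (+ 8 ℤ.* a) (+ 8 ℤ.* b))
      where
      eq₁ : ∀ a b → + 8 ℤ.* (a ℤ.+ b) ≡ + 8 ℤ.* a ℤ.+ + 8 ℤ.* b
      eq₁ = solve-∀
      eq₂ : ∀ a b → + 8 ℤ.* (a ℤ.- b) ≡ + 8 ℤ.* a ℤ.- + 8 ℤ.* b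
      eq₂ = solve-∀

    G-even : ∀ a → G (ℤ.- a) ≈ G a
    G-even a = trans (D-≡ (eq a)) (D-even (+ 8 ℤ.* a))
      where
      eq : ∀ a → + 8 ℤ.* (ℤ.- a) ≡ ℤ.- (+ 8 ℤ.* a)
      eq = solve-∀

    private
      G-periodℕ : ∀ a k → G (a ℤ.+ + k ℤ.* + n) ≈ G a
      G-periodℕ a zero    = G-≡ (ℤ.+-identityʳ a)
      G-periodℕ a (suc k) = begin
        D (+ 8 ℤ.* (a ℤ.+ + suc k ℤ.* + n))            ≈⟨ D-≡ (eq a (+ k) (+ n)) ⟩
        D (+ 8 ℤ.* (a ℤ.+ + k ℤ.* + n) ℤ.+ + 8 ℤ.* + n) ≈⟨ D-period _ ⟩
        G (a ℤ.+ + k ℤ.* + n)                          ≈⟨ G-periodℕ a k ⟩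
        G a                                            ∎
        where
        eq : ∀ a k n → + 8 ℤ.* (a ℤ.+ (1ℤ ℤ.+ k) ℤ.* n) ≡ + 8 ℤ.* (a ℤ.+ k ℤ.* n) ℤ.+ + 8 ℤ.* n
        eq = solve-∀

    G-period : ∀ a k → G (a ℤ.+ k ℤ.* + n) ≈ G a
    G-period a (+ k)      = G-periodℕ a k
    G-period a (-[1+ k ]) = trans (sym (G-periodℕ _ (suc k))) (G-≡ (eq a (+ suc k) (+ n)))
      where
      eq : ∀ a k n → a ℤ.+ ℤ.- k ℤ.* n ℤ.+ k ℤ.* n ≡ a
      eq = solve-∀

    -- The sum Σ over a period satisfies 2 Σ = 2 G z Σ.
    ∑G≈0 : ∀ m → 0 ℕ.< m → m ℕ.< n → S (λ k → G (+ m ℤ.* + k)) n ≈ 0#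
    ∑G≈0 m 0<m m<n = *-cancel-0 1-g≉0 (*-cancel-0 2≉0 (begin
        2# * ((1# - g 1) * S g n)
          ≈⟨ solve 2 (λ x s → let 2ₛ = con 1ℤ :+ con 1ℤ in
               2ₛ :* ((con 1ℤ :- x) :* s) := s :+ s :- 2ₛ :* x :* s) refl (g 1) (S g n) ⟩
        S g n + S g n - 2# * g 1 * S g n
          ≈⟨ +-cong (+-congʳ (trans (shift (g ∘ suc) (g-period 1)) (shift g (g-period 0))))
                    (-‿cong (*-congˡ (shift g (g-period 0)))) ⟨
        S (λ k → g (suc (suc k))) n + S g n - 2# * g 1 * S (g ∘ suc) n
          ≈⟨ +-congʳ (S-+ (λ k → g (suc (suc k))) g n) ⟨
        S (λ k → g (suc (suc k)) + g k) n - 2# * g 1 * S (g ∘ suc) n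
          ≈⟨ +-congʳ (trans (S-cong recurrence n) (S-* (2# * g 1) (g ∘ suc) n)) ⟩
        2# * g 1 * S (g ∘ suc) n - 2# * g 1 * S (g ∘ suc) n
          ≈⟨ -‿inverseʳ _ ⟩
        0# ∎))
      where
      g : ℕ → Carrier
      g k = G (+ m ℤ.* + k)
      1-g≉0 : ¬ 1# - g 1 ≈ 0#
      1-g≉0 1-g≈0 = D-8≉1 m 0<m m<n
        (trans (G-≡ (≡.sym (ℤ.*-identityʳ (+ m)))) (sym (x∙y⁻¹≈ε⇒x≈y _ _ 1-g≈0)))
      g-period : ∀ k → g (k ℕ.+ n) ≈ g k
      g-period k = trans (G-≡ (eq (+ m) (+ k) (+ n))) (G-period (+ m ℤ.* + k) (+ m))
        where
        eq : ∀ m k n → m ℤ.* (k ℤ.+ n) ≡ m ℤ.* k ℤ.+ m ℤ.* n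
        eq = solve-∀
      shift : ∀ f → f n ≈ f 0 → S (f ∘ suc) n ≈ S f n
      shift f fn≈f0 = begin
        S (f ∘ suc) n              ≈⟨ solve 2 (λ s x → s := x :+ s :- x) refl _ _ ⟩
        S f (suc n) - f 0          ≈⟨ +-cong (S-last f n) (-‿cong (sym fn≈f0)) ⟩
        S f n + f n - f n          ≈⟨ solve 2 (λ s x → s :+ x :- x := s) refl _ _ ⟩
        S f n                      ∎
      -- The three-term recurrence of cos kθ. Summed over a period, where shifting the index changes
      -- nothing, it becomes the equation for Σ.
      recurrence : ∀ k → g (suc (suc k)) + g k ≈ 2# * g 1 * g (suc k)
      recurrence k = begin
        g (suc (suc k)) + g k
          ≈⟨ +-cong (G-≡ (eq₁ (+ m) (+ k))) (G-≡ (eq₂ (+ m) (+ k))) ⟩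
        G (+ m ℤ.* + suc k ℤ.+ + m ℤ.* 1ℤ) + G (+ m ℤ.* + suc k ℤ.- + m ℤ.* 1ℤ)
          ≈⟨ G-product (+ m ℤ.* + suc k) (+ m ℤ.* 1ℤ) ⟩
        2# * (g (suc k) * g 1)
          ≈⟨ solve 3 (λ a x y → a :* (x :* y) := a :* y :* x) refl _ _ _ ⟩
        2# * g 1 * g (suc k) ∎
        where
        eq₁ : ∀ m k → m ℤ.* (1ℤ ℤ.+ (1ℤ ℤ.+ k)) ≡ m ℤ.* (1ℤ ℤ.+ k) ℤ.+ m ℤ.* 1ℤ
        eq₁ = solve-∀
        eq₂ : ∀ m k → m ℤ.* k ≡ m ℤ.* (1ℤ ℤ.+ k) ℤ.- m ℤ.* 1ℤ
        eq₂ = solve-∀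

-- Frequencies of a pattern

-- The effect on the frequencies of multiplying Σ cos zθ by 2 cos rθ.
spread : ℤ → List ℤ → List ℤ
spread r L = List.map (ℤ._+ r) L ++ List.map (ℤ._- r) L

spread^ : ℤ → ℕ → List ℤ → List ℤ
spread^ r zero    L = L
spread^ r (suc h) L = spread r (spread^ r h L)

-- The empty product is 1 = cos 0, hence the single frequency 0 to start from.
frequencies : ∀ {t} → (Fin t → ℤ) → (Fin t → ℕ) → List ℤ
frequencies {zero}  r h = 0ℤ ∷ []
frequencies {suc t} r h = spread^ (r zero) (h zero) (frequencies (r ∘ suc) (h ∘ suc))

zeros : List ℤ → ℕ
zeros []                = 0
zeros (+ zero     ∷ L) = suc (zeros L)
zeros (+[1+ _ ]   ∷ L) = zeros L
zeros (-[1+ _ ]   ∷ L) = zeros L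

-- A bound for the absolute value of every frequency in the list; a sum serves as well as a maximum.
totalSize : List ℤ → ℕ
totalSize []      = 0
totalSize (z ∷ L) = ∣ z ∣ ℕ.+ totalSize L

-- The -1 is common to both kinds of frequency, so the constant term counts all of them, whereas
-- only the zero frequencies contribute to the slope.
linear : List ℤ → MPoly 1
linear L = cartesianProductWith mulTerm (constₚ (+ zeros L / 1)) (varₚ zero)
        ++ constₚ ((ℤ.- + length L) / 1)

patternFrequencies : Pattern → List ℤ
patternFrequencies P = frequencies (Pattern.r P) (Pattern.h P)

sumℕ : ∀ {m} → (Fin m → ℕ) → ℕ
sumℕ = Vector.foldr ℕ._+_ 0

≤-sumℕ : ∀ {m} (f : Fin m → ℕ) i → f i ℕ.≤ sumℕ f
≤-sumℕ f zero    = ℕ.m≤m+n _ _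
≤-sumℕ f (suc i) = ℕ.m≤n⇒m≤o+n (f zero) (≤-sumℕ (f ∘ suc) i)

-- Values of pattern sums at the cosines

module PatternValue {c ℓ₁ ℓ₂} (ℝ : RealField c ℓ₁ ℓ₂)
  (cos : RealField.Carrier ℝ → RealField.Carrier ℝ) (isCosine : IsCosine ℝ cos)
  (π : RealField.Carrier ℝ) (isPi : IsPi ℝ cos π) where

  open RealProperties ℝ
  open CosineProduct ℝ
  open IsPi isPi
  open Evaluation commutativeRing fromℚ fromℚ-homomorphism
  open SetoidReasoning setoid
  private
    module SR = RawSR (RawRing.rawSemiring rawRing)
    module Σ = MonoidSum +-commutativeMonoid
    module Π = MonoidSum *-commutativeMonoid
  open import Algebra.Properties.CommutativeSemigroup +-commutativeSemigroup using (x∙yz≈y∙xz)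

  module _ (n : ℕ) .{{n>1 : NonTrivial n}} where
    private instance
      n≢0 : NonZero n
      n≢0 = ℕ.nonTrivial⇒nonZero n

    private
      -- `ω` is the mesh π/4n, so 2n steps from 0 reach π/2.
      1/n ½ ω : Carrier
      1/n = fromℚ (1ℤ / n)
      ½   = fromℚ (1ℤ / 2)
      ω   = 1/n * (½ * π/2)

      D : ℤ → Carrier
      D m = cos (fromℤ m * ω)

      2*½ : fromℕ 2 * ½ ≈ 1#
      2*½ = n*1/n≈1 2

      0<ω : 0# < ω
      0<ω = *-pos (1/n-pos n) (*-pos (1/n-pos 2) π/2-positive)

      2n*ω≈π/2 : fromℕ (2 ℕ.* n) * ω ≈ π/2
      2n*ω≈π/2 = begin
        fromℕ (2 ℕ.* n) * ω
          ≈⟨ *-congʳ (fromℕ-* 2 n) ⟩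
        fromℕ 2 * fromℕ n * (1/n * (½ * π/2))
          ≈⟨ solve 5 (λ a b x y z → a :* b :* (x :* (y :* z)) := a :* y :* (b :* x) :* z) refl _ _ _ _ _ ⟩
        fromℕ 2 * ½ * (fromℕ n * 1/n) * π/2
          ≈⟨ *-congʳ (*-cong 2*½ (n*1/n≈1 n)) ⟩
        1# * 1# * π/2
          ≈⟨ solve 1 (λ x → con 1ℤ :* con 1ℤ :* x := x) refl _ ⟩
        π/2 ∎

      D-product : ∀ a b → D (a ℤ.+ b) + D (a ℤ.- b) ≈ 2# * (D a * D b)
      D-product a b = cosine-product cos isCosine
        (trans (*-congʳ (fromℤ-+ a b)) (distribʳ _ _ _))
        (trans (*-congʳ (trans (fromℤ-+ a (ℤ.- b)) (+-congˡ (fromℤ-neg b))))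
          (solve 3 (λ a b w → (a :- b) :* w := a :* w :- b :* w) refl _ _ ω))

      D-2n≈0 : D (+ (2 ℕ.* n)) ≈ 0#
      D-2n≈0 = trans (cos-cong cos isCosine 2n*ω≈π/2) π/2-zero

      D≉0 : ∀ m → 0 ℕ.< m → m ℕ.< 2 ℕ.* n → ¬ D (+ m) ≈ 0#
      D≉0 m 0<m m<2n = π/2-least _ (positive m 0<m)
        (<-respˡ (+-identityˡ _) (<-respʳ
          (begin
            fromℕ k * ω + fromℕ m * ω   ≈⟨ distribʳ _ _ _ ⟨
            (fromℕ k + fromℕ m) * ω     ≈⟨ *-congʳ (fromℕ-+ k m) ⟨
            fromℕ (k ℕ.+ m) * ω         ≡⟨ ≡.cong (λ j → fromℕ j * ω) (ℕ.m∸n+n≡m (ℕ.<⇒≤ m<2n)) ⟩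
            fromℕ (2 ℕ.* n) * ω         ≈⟨ 2n*ω≈π/2 ⟩
            π/2                         ∎)
          (+-monoˡ-< (fromℕ m * ω) (positive k (ℕ.m<n⇒0<n∸m m<2n)))))
        where
        k = 2 ℕ.* n ℕ.∸ m
        positive : ∀ j → 0 ℕ.< j → 0# < fromℕ j * ω
        positive j 0<j = *-pos (fromℕ-pos j {{ℕ.>-nonZero 0<j}}) 0<ω

    open CosineGrid.Grid ℝ n D D-product D-2n≈0 D≉0

    α≈G : ∀ k → α ℝ cos π n k ≈ G (+ label {n} k)
    α≈G k = cos-cong cos isCosine (begin
      fromℚ (+ (2 ℕ.* m) / n) * π
        ≈⟨ *-congʳ (fromℚ-/ (+ (2 ℕ.* m)) n) ⟩
      fromℕ (2 ℕ.* m) * 1/n * π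
        ≈⟨ *-congʳ (*-congʳ (fromℕ-* 2 m)) ⟩
      fromℕ 2 * fromℕ m * 1/n * π
        -- Inserting (2 · ½)² supplies the two halves contained in `ω` and turns the factor 2 into
        -- 8.
        ≈⟨ solve 4 (λ a b c d → a :* b :* c :* d := con 1ℤ :* con 1ℤ :* (a :* b :* c :* d)) refl _ _ _ _ ⟩
      1# * 1# * (fromℕ 2 * fromℕ m * 1/n * π)
        ≈⟨ *-congʳ (*-cong 2*½ 2*½) ⟨
      fromℕ 2 * ½ * (fromℕ 2 * ½) * (fromℕ 2 * fromℕ m * 1/n * π)
        ≈⟨ solve 5 (λ a h b c d → a :* h :* (a :* h) :* (a :* b :* c :* d)
                               := a :* (a :* a) :* b :* (c :* (h :* (h :* d)))) refl _ _ _ _ _ ⟩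
      fromℕ 2 * (fromℕ 2 * fromℕ 2) * fromℕ m * (1/n * (½ * π/2))
        ≈⟨ *-congʳ (*-congʳ (trans (fromℕ-* 2 4) (*-congˡ (fromℕ-* 2 2)))) ⟨
      fromℕ 8 * fromℕ m * ω
        ≈⟨ *-congʳ (fromℤ-* (+ 8) (+ m)) ⟨
      fromℤ (+ 8 ℤ.* + m) * ω ∎)
      where m = label {n} k

    -- By periodicity the reduction modulo n in `σ` is invisible to the cosine, so the permuted
    -- index may be replaced by the integer product, to which the product formula applies.
    α-σ : ∀ r cop k → α ℝ cos π n (σ {n} r cop k) ≈ G (r ℤ.* + label {n} k)
    α-σ r cop k = begin
      α ℝ cos π n (σ {n} r cop k)
        ≈⟨ α≈G (σ {n} r cop k) ⟩
      G (+ label {n} (σ {n} r cop k))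
        ≡⟨ ≡.cong (λ j → G (+ j)) (label-σ {n} r cop k) ⟩
      G (+ (rk %ℕ n))
        ≈⟨ G-period (+ (rk %ℕ n)) (rk /ℕ n) ⟨
      G (+ (rk %ℕ n) ℤ.+ (rk /ℕ n) ℤ.* + n)
        ≡⟨ ≡.cong G (a≡a%ℕn+[a/ℕn]*n rk n) ⟨
      G rk ∎
      where rk = r ℤ.* + label {n} k

    ∑ : (ℤ → Carrier) → List ℤ → Carrier
    ∑ f = List.foldr (λ z s → f z + s) 0#

    ∑-++ : ∀ f L L′ → ∑ f (L ++ L′) ≈ ∑ f L + ∑ f L′
    ∑-++ f []      L′ = sym (+-identityˡ _)
    ∑-++ f (z ∷ L) L′ = trans (+-congˡ (∑-++ f L L′)) (sym (+-assoc _ _ _))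

    private
      G[_] : ℤ → ℤ → Carrier
      G[ k ] z = G (z ℤ.* k)

    ∑-spread : ∀ r k L → ∑ G[ k ] (spread r L) ≈ 2# * G (r ℤ.* k) * ∑ G[ k ] L
    ∑-spread r k L = trans (∑-++ G[ k ] (List.map (ℤ._+ r) L) _) (split L)
      where
      split : ∀ L → ∑ G[ k ] (List.map (ℤ._+ r) L) + ∑ G[ k ] (List.map (ℤ._- r) L)
                      ≈ 2# * G (r ℤ.* k) * ∑ G[ k ] L
      split []      = trans (+-identityˡ 0#) (sym (zeroʳ _))
      split (z ∷ L) = begin
        G ((z ℤ.+ r) ℤ.* k) + ∑ G[ k ] (List.map (ℤ._+ r) L)
          + (G ((z ℤ.- r) ℤ.* k) + ∑ G[ k ] (List.map (ℤ._- r) L))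
          ≈⟨ solve 4 (λ a s b t → a :+ s :+ (b :+ t) := a :+ b :+ (s :+ t)) refl _ _ _ _ ⟩
        G ((z ℤ.+ r) ℤ.* k) + G ((z ℤ.- r) ℤ.* k)
          + (∑ G[ k ] (List.map (ℤ._+ r) L) + ∑ G[ k ] (List.map (ℤ._- r) L))
          ≈⟨ +-cong (+-cong (reflexive (≡.cong G (eq₁ z r k))) (reflexive (≡.cong G (eq₂ z r k)))) (split L) ⟩
        G (z ℤ.* k ℤ.+ r ℤ.* k) + G (z ℤ.* k ℤ.- r ℤ.* k) + 2# * G (r ℤ.* k) * ∑ G[ k ] L
          ≈⟨ +-congʳ (G-product (z ℤ.* k) (r ℤ.* k)) ⟩
        2# * (G (z ℤ.* k) * G (r ℤ.* k)) + 2# * G (r ℤ.* k) * ∑ G[ k ] L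
          ≈⟨ solve 4 (λ t a b s → t :* (a :* b) :+ t :* b :* s := t :* b :* (a :+ s)) refl _ _ _ _ ⟩
        2# * G (r ℤ.* k) * (G (z ℤ.* k) + ∑ G[ k ] L) ∎
        where
        eq₁ : ∀ z r k → (z ℤ.+ r) ℤ.* k ≡ z ℤ.* k ℤ.+ r ℤ.* k
        eq₁ = solve-∀
        eq₂ : ∀ z r k → (z ℤ.- r) ℤ.* k ≡ z ℤ.* k ℤ.- r ℤ.* k
        eq₂ = solve-∀

    ∑-spread^ : ∀ r k h L → ∑ G[ k ] (spread^ r h L) ≈ (2# * G (r ℤ.* k)) ^ h * ∑ G[ k ] L
    ∑-spread^ r k zero    L = sym (*-identityˡ _)
    ∑-spread^ r k (suc h) L = trans (∑-spread r k (spread^ r h L))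
      (trans (*-congˡ (∑-spread^ r k h L)) (sym (*-assoc _ _ _)))

    ∑-frequencies : ∀ {t} (r : Fin t → ℤ) (h : Fin t → ℕ) k →
      ∑ G[ k ] (frequencies r h) ≈ SR.product λ j → (2# * G (r j ℤ.* k)) ^ h j
    ∑-frequencies {zero}  r h k = trans (+-identityʳ _) G-0
    ∑-frequencies {suc t} r h k =
      trans (∑-spread^ (r zero) k (h zero) _) (*-congˡ (∑-frequencies (r ∘ suc) (h ∘ suc) k))

    -- Orthogonality over Ωₙ; the full period also contains k = 0, where cos 0 = 1.

    ∑Ω : (ℤ → Carrier) → Carrier
    ∑Ω f = SR.sum λ (k : Ω n) → f (+ label {n} k)

    ∑Ω-0 : ∑Ω (λ k → G (0ℤ ℤ.* k)) ≈ fromℕ n - 1#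
    ∑Ω-0 = begin
      S (λ _ → G 0ℤ) (pred n)
        ≈⟨ S-cong (λ _ → G-0) (pred n) ⟩
      S (λ _ → 1#) (pred n)
        ≈⟨ S-1 (pred n) ⟩
      fromℕ (pred n)
        ≈⟨ solve 1 (λ x → x := con 1ℤ :+ x :- con 1ℤ) refl _ ⟩
      1# + fromℕ (pred n) - 1#
        ≈⟨ +-congʳ (fromℕ-suc (pred n)) ⟨
      fromℕ (suc (pred n)) - 1#
        ≡⟨ ≡.cong (λ m → fromℕ m - 1#) (ℕ.suc-pred n) ⟩
      fromℕ n - 1# ∎
      where
      S-1 : ∀ m → S (λ _ → 1#) m ≈ fromℕ m
      S-1 zero    = sym fromℕ-0
      S-1 (suc m) = trans (+-congˡ (S-1 m)) (sym (fromℕ-suc m))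

    ∑Ω-pos : ∀ m → 0 ℕ.< m → m ℕ.< n → ∑Ω (λ k → G (+ m ℤ.* k)) ≈ - 1#
    ∑Ω-pos m 0<m m<n = begin
      S (g ∘ suc) (pred n)
        ≈⟨ solve 2 (λ x s → s := x :+ s :- x) refl _ _ ⟩
      S g (suc (pred n)) - g 0
        ≈⟨ +-cong (trans (reflexive (≡.cong (S g) (ℕ.suc-pred n))) (∑G≈0 m 0<m m<n))
             (-‿cong (trans (reflexive (≡.cong G (ℤ.*-zeroʳ (+ m)))) G-0)) ⟩
      0# - 1#
        ≈⟨ +-identityˡ _ ⟩
      - 1# ∎
      where
      g : ℕ → Carrier
      g k = G (+ m ℤ.* + k)

    ∑Ω-neg : ∀ m → 0 ℕ.< m → m ℕ.< n → ∑Ω (λ k → G (ℤ.- + m ℤ.* k)) ≈ - 1#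
    ∑Ω-neg m 0<m m<n = trans
      (S-cong (λ k → trans (reflexive (≡.cong G (≡.sym (ℤ.neg-distribˡ-* (+ m) (+ suc k))))) (G-even (+ m ℤ.* + suc k))) (pred n))
      (∑Ω-pos m 0<m m<n)

    -- The size bound keeps every frequency below n in absolute value, so a nonzero one is never a
    -- multiple of n; only the sign of `z` then matters.
    ∑Ω-∑ : ∀ L → totalSize L ℕ.< n →
      ∑Ω (λ k → ∑ G[ k ] L) ≈ fromℕ (zeros L) * fromℕ n + fromℤ (ℤ.- + length L)
    ∑Ω-∑ []      _      = begin
      S (λ _ → 0#) (pred n)          ≈⟨ S-0 (pred n) ⟩
      0#                             ≈⟨ solve 1 (λ x → con 0ℤ := con 0ℤ :* x :+ con 0ℤ) refl _ ⟩
      0# * fromℕ n + 0#              ≈⟨ +-cong (*-congʳ fromℕ-0) fromℕ-0 ⟨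
      fromℕ 0 * fromℕ n + fromℤ 0ℤ   ∎
      where
      S-0 : ∀ m → S (λ _ → 0#) m ≈ 0#
      S-0 zero    = refl
      S-0 (suc m) = trans (+-identityˡ _) (S-0 m)
    ∑Ω-∑ (z ∷ L) size<n = trans
      (S-+ (λ k → G (z ℤ.* + suc k)) (λ k → ∑ G[ + suc k ] L) (pred n))
      (trans (+-congˡ (∑Ω-∑ L (ℕ.≤-<-trans (ℕ.m≤n+m (totalSize L) ∣ z ∣) size<n))) (trans (first z (ℕ.≤-<-trans (ℕ.m≤m+n ∣ z ∣ _) size<n))
        (+-congˡ (sym negsuc))))
      where
      negsuc : fromℤ (ℤ.- + suc (length L)) ≈ - 1# + fromℤ (ℤ.- + length L)
      negsuc = trans (fromℤ-neg (+ suc (length L))) (trans (-‿cong (fromℕ-suc (length L)))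
        (trans (solve 1 (λ x → :- (con 1ℤ :+ x) := :- con 1ℤ :+ :- x) refl _) (+-congˡ (sym (fromℤ-neg (+ length L))))))
      first : ∀ z → ∣ z ∣ ℕ.< n →
        ∑Ω (λ k → G (z ℤ.* k)) + (fromℕ (zeros L) * fromℕ n + fromℤ (ℤ.- + length L))
        ≈ fromℕ (zeros (z ∷ L)) * fromℕ n + (- 1# + fromℤ (ℤ.- + length L))
      first (+ zero) _ = begin
        ∑Ω (λ k → G (0ℤ ℤ.* k)) + (fromℕ (zeros L) * fromℕ n + fromℤ (ℤ.- + length L))
          ≈⟨ +-congʳ ∑Ω-0 ⟩
        fromℕ n - 1# + (fromℕ (zeros L) * fromℕ n + fromℤ (ℤ.- + length L))
          ≈⟨ solve 3 (λ n z l → n :- con 1ℤ :+ (z :* n :+ l) := (con 1ℤ :+ z) :* n :+ (:- con 1ℤ :+ l)) refl _ _ _ ⟩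
        (1# + fromℕ (zeros L)) * fromℕ n + (- 1# + fromℤ (ℤ.- + length L))
          ≈⟨ +-congʳ (*-congʳ (fromℕ-suc (zeros L))) ⟨
        fromℕ (suc (zeros L)) * fromℕ n + (- 1# + fromℤ (ℤ.- + length L)) ∎
      first +[1+ m ] m<n = trans (+-congʳ (∑Ω-pos (suc m) ℕ.z<s m<n)) (x∙yz≈y∙xz _ _ _)
      first -[1+ m ] m<n = trans (+-congʳ (∑Ω-neg (suc m) ℕ.z<s m<n)) (x∙yz≈y∙xz _ _ _)

    -- The value is expressed through a polynomial that does not depend on n, so that it can be
    -- substituted into `Ψ` once and for all.
    patternSum-value : ∀ P cop → totalSize (patternFrequencies P) ℕ.< n →
      evaluate (patternSum P n cop) (α ℝ cos π n)
        ≈ evaluate (linear (patternFrequencies P)) (λ _ → fromℚ (+ n / 1))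
    patternSum-value P cop size<n = begin
      evaluate (patternSum P n cop) x
        ≈⟨ evaluate-sum (λ k → PR.product λ j → factor k j PR.^ h j) x ⟩
      SR.sum (λ k → evaluate (PR.product λ j → factor k j PR.^ h j) x)
        ≈⟨ Σ.sum-cong-≋ (λ k → trans (evaluate-product (λ j → factor k j PR.^ h j) x)
             (Π.sum-cong-≋ λ j → trans (evaluate-^ (factor k j) (h j) x) (^-congˡ (h j) (factor-value k j)))) ⟩
      SR.sum (λ k → SR.product λ j → (2# * G (r j ℤ.* + label {n} k)) ^ h j)
        ≈⟨ Σ.sum-cong-≋ (λ k → ∑-frequencies r h (+ label {n} k)) ⟨
      ∑Ω (λ k → ∑ G[ k ] L)
        ≈⟨ ∑Ω-∑ L size<n ⟩
      fromℕ (zeros L) * fromℕ n + fromℤ (ℤ.- + length L)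
        ≈⟨ +-cong (trans (evaluate-* (constₚ (+ zeros L / 1)) (varₚ zero) y)
             (*-cong (evaluate-const (+ zeros L / 1) y) (evaluate-var zero y)))
             (evaluate-const ((ℤ.- + length L) / 1) y) ⟨
      evaluate (cartesianProductWith mulTerm (constₚ (+ zeros L / 1)) (varₚ zero)) y
        + evaluate (constₚ ((ℤ.- + length L) / 1)) y
        ≈⟨ evaluate-++ (cartesianProductWith mulTerm (constₚ (+ zeros L / 1)) (varₚ zero)) (constₚ ((ℤ.- + length L) / 1)) y ⟨
      evaluate (linear L) y ∎
      where
      open Pattern P
      module PR = RawSR (RawRing.rawSemiring (polyRing (pred n)))
      L = patternFrequencies P
      x = α ℝ cos π n
      y : Fin 1 → Carrier
      y _ = fromℚ (+ n / 1)
      σⱼ : ∀ j → Ω n → Ω n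
      σⱼ j = σ {n} (r j) (coprime-factor (+ n) r cop j)
      factor : Ω n → Fin (suc t-1) → MPoly (pred n)
      factor k j = cartesianProductWith mulTerm (constₚ (+ 2 / 1)) (varₚ (σⱼ j k))
      factor-value : ∀ k j → evaluate (factor k j) x ≈ 2# * G (r j ℤ.* + label {n} k)
      factor-value k j = trans (evaluate-* (constₚ (+ 2 / 1)) (varₚ (σⱼ j k)) x)
        (*-cong (trans (evaluate-const (+ 2 / 1) x) (trans (fromℕ-suc 1) (+-congˡ fromℕ-1)))
          (trans (evaluate-var (σⱼ j k) x) (α-σ (r j) (coprime-factor (+ n) r cop j) k)))

-- Substitution of the affine values into `Ψ`

theorem4p3 : ∀ {c ℓ₁ ℓ₂} (ℝ : RealField c ℓ₁ ℓ₂) →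
    let open RealField ℝ in
    (cos : Carrier → Carrier) → IsCosine ℝ cos →
    (π : Carrier) → IsPi ℝ cos π →
    (F : Family) (G : UniformlyPatternGenerated F) →
    ∃₂ λ (n₁ : ℤ) (R∞ : MPoly 1) →
      (n : ℕ) .{{_ : NonTrivial n}} → n₁ ≤ + n →
      gcd (+ n) (UniformlyPatternGenerated.modulus G) ≡ 1ℤ →
      cosineValue ℝ cos π F n ≈ fromℚ (evalℚ R∞ (+ n / 1))
theorem4p3 ℝ cos isCosine π isPi F G = n₀ ℤ.⊔ + suc size , R∞ , agree
  where
  open UniformlyPatternGenerated G
  open RealProperties ℝ
  open Evaluation commutativeRing fromℚ fromℚ-homomorphism
  open PatternValue ℝ cos isCosine π isPi
  open SetoidReasoning setoid

  lines : Fin M → MPoly 1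
  lines m = linear (patternFrequencies (patterns m))

  sizes : Fin M → ℕ
  sizes m = totalSize (patternFrequencies (patterns m))

  -- One threshold for all patterns: the sum dominates the total size of each, and the successor in
  -- the bound makes the comparison with n strict.
  size : ℕ
  size = sumℕ sizes

  R∞ : MPoly 1
  R∞ = eval (polyRing 1) constₚ Ψ lines

  agree : (n : ℕ) .{{_ : NonTrivial n}} → n₀ ℤ.⊔ + suc size ≤ + n → gcd (+ n) modulus ≡ 1ℤ →
          cosineValue ℝ cos π F n ≈ fromℚ (evalℚ R∞ (+ n / 1))
  agree n n₁≤n cop = begin
    evaluate (F n) (α ℝ cos π n)
      ≈⟨ evaluate-respects-≈ₚ (F n) (eval (polyRing (pred n)) constₚ Ψ T) (α ℝ cos π n) (generates n (ℤ.≤-trans (ℤ.i≤i⊔j n₀ _) n₁≤n) cop) ⟩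
    evaluate (eval (polyRing (pred n)) constₚ Ψ T) (α ℝ cos π n)
      ≈⟨ evaluate-substitution Ψ T (α ℝ cos π n) ⟩
    evaluate Ψ (λ m → evaluate (T m) (α ℝ cos π n))
      ≈⟨ evaluate-cong Ψ (λ m → patternSum-value n (patterns m) (cops m) (size<n m)) ⟩
    evaluate Ψ (λ m → evaluate (lines m) (λ _ → fromℚ (+ n / 1)))
      ≈⟨ evaluate-substitution Ψ lines (λ _ → fromℚ (+ n / 1)) ⟨
    evaluate R∞ (λ _ → fromℚ (+ n / 1))
      ≈⟨ ι-evaluate R∞ (λ _ → + n / 1) ⟨
    fromℚ (evalℚ R∞ (+ n / 1)) ∎
    where
    cops : ∀ m → gcd (+ n) (∏ (Pattern.r (patterns m))) ≡ 1ℤ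
    cops = coprime-factor (+ n) (λ m → ∏ (Pattern.r (patterns m))) cop
    T : Fin M → MPoly (pred n)
    T m = patternSum (patterns m) n (cops m)
    size<n : ∀ m → sizes m ℕ.< n
    size<n m = ℕ.≤-trans (ℕ.s≤s (≤-sumℕ sizes m))
      (ℤ.drop‿+≤+ (ℤ.≤-trans (ℤ.i≤j⊔i n₀ (+ suc size)) n₁≤n))
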